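{- Let $f(X)$ be a polynomial with real coefficients of degree $n\ge 3$ with $f(0)\neq 0$, and assume that its reciprocal $\tilde f(X)=X^nf(\frac1X)$ has no roots in the sector $S_{\tilde v,\frac{\pi}{n}}$ for some positive real number $\tilde v$. Then $f$ has no zeros in the open lens-shaped region $L_{\tilde v,\frac{\pi}{n}}$ consisting of all complex numbers $x+iy$ ($x,y\in\mathbb{R}$) with $$x\in\left(0,\frac{1}{\tilde v}\right),\qquad |y|<\frac{ -1}{2\tilde v\tan\frac{\pi}{n}}+\sqrt{\frac{1}{4\tilde v^2\sin^2\frac{\pi}{n}}-\left(x-\frac{1}{2\tilde v}\right)^2}.$$
   Context: For real numbers $v,\theta$ with $0<\theta<\pi$, define the open sector $S_{v,\theta}=\{z=v+\rho e^{i\varphi}\in\mathbb{C}:\rho>0,\ |\varphi|<\theta\}$ (with $\varphi$ real). -}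

module Defs where

open import Algebra.Bundles using (CommutativeRing)
open import Algebra.Core using (Op₁; Op₂)
open import Algebra.Structures using (IsCommutativeRing)
import Algebra.Properties.CommutativeSemiring.Exp as Exp
import Algebra.Properties.Ring as RingProperties
import Algebra.Properties.Semiring.Mult as Mult
import Algebra.Properties.Semiring.Sum as Sum
open import Data.Fin.Base using (Fin; toℕ; opposite)
open import Data.Fin.Permutation using (reverse)
open import Data.Fin.Properties using (opposite-prop; toℕ<n)
open import Data.Maybe.Base using (nothing)
open import Data.Nat.Base as ℕ using (ℕ; zero; suc; _!)
import Data.Nat.Properties as ℕ
open import Data.Product.Base using (∃; ∃-syntax; _×_; _,_; proj₁; proj₂)
open import Data.Vec.Functional as Vector using (Vector)
open import Function.Base using (_∘_)
open import Level using (_⊔_) renaming (suc to lsuc)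
open import Relation.Binary.Core using (Rel)
import Relation.Binary.Construct.StrictToNonStrict as ToNonStrict
open import Relation.Binary.Definitions using (tri<; tri≈; tri>)
open import Relation.Binary.PropositionalEquality.Core as ≡ using (_≡_)
import Relation.Binary.Reasoning.Setoid as SetoidReasoning
open import Relation.Binary.Structures using (IsStrictTotalOrder)
open import Relation.Nullary using (¬_; yes; no)
open import Relation.Unary using (Pred; Satisfiable)
import Tactic.RingSolver.NonReflective as RingSolver
open import Tactic.RingSolver.Core.AlmostCommutativeRing
  using (AlmostCommutativeRing; fromCommutativeRing)

-- The field of real numbers, characterised (up to unique isomorphism) as the
-- ordered field with the least upper bound property.  A supremum s of P is an
-- upper bound of P such that every y < s is exceeded by some element of P.
-- Together with trichotomy this form of completeness yields excluded middle
-- at level c ⊔ ℓ₁ ⊔ ℓ₂ (take the supremum of {0} ∪ {1 | Q} and compare it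
-- with 1/2), so these are the classical reals.
record CompleteOrderedField c ℓ₁ ℓ₂ : Set (lsuc (c ⊔ ℓ₁ ⊔ ℓ₂)) where
  infix  8 -_
  infixl 7 _*_
  infixl 6 _+_
  infix  4 _≈_ _<_
  field
    Carrier            : Set c
    _≈_                : Rel Carrier ℓ₁
    _<_                : Rel Carrier ℓ₂
    _+_                : Op₂ Carrier
    _*_                : Op₂ Carrier
    -_                 : Op₁ Carrier
    0#                 : Carrier
    1#                 : Carrier
    isCommutativeRing  : IsCommutativeRing _≈_ _+_ _*_ -_ 0# 1#
    isStrictTotalOrder : IsStrictTotalOrder _≈_ _<_

  open ToNonStrict _≈_ _<_ public using (_≤_)

  IsUpperBound : ∀ {p} → Pred Carrier p → Pred Carrier (c ⊔ ℓ₁ ⊔ ℓ₂ ⊔ p)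
  IsUpperBound P u = ∀ {x} → P x → x ≤ u

  IsSupremum : ∀ {p} → Pred Carrier p → Pred Carrier (c ⊔ ℓ₁ ⊔ ℓ₂ ⊔ p)
  IsSupremum P s = IsUpperBound P s × (∀ {y} → y < s → ∃[ x ] P x × y < x)

  field
    0≉1       : ¬ 0# ≈ 1#
    inverse   : ∀ {x} → ¬ x ≈ 0# → ∃[ y ] x * y ≈ 1#
    +-monoʳ-< : ∀ x {y z} → y < z → x + y < x + z
    *-pos     : ∀ {x y} → 0# < x → 0# < y → 0# < x * y
    supremum  : (P : Pred Carrier (c ⊔ ℓ₁ ⊔ ℓ₂)) → Satisfiable P →
                ∃ (IsUpperBound P) → ∃ (IsSupremum P)

  commutativeRing : CommutativeRing c ℓ₁
  commutativeRing = record { isCommutativeRing = isCommutativeRing }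

  open CommutativeRing commutativeRing public
    hiding (Carrier; _≈_; _+_; _*_; -_; 0#; 1#; isCommutativeRing)
  open IsStrictTotalOrder isStrictTotalOrder public
    using (compare; _≟_; _<?_; <-resp-≈; <-respˡ-≈; <-respʳ-≈)
    renaming (trans to <-trans; irrefl to <-irrefl; asym to <-asym)

module Analysis {c ℓ₁ ℓ₂} (R : CompleteOrderedField c ℓ₁ ℓ₂) where

  open CompleteOrderedField R renaming (Carrier to ℝ)
  open Mult semiring using () renaming (_×_ to _·_)
  open Exp commutativeSemiring using (_^_)

  fromℕ : ℕ → ℝ
  fromℕ n = n · 1#

  -- Total inverse with the convention 0 ⁻¹ = 0; below it is only ever applied
  -- to nonzero arguments.
  infix 8 _⁻¹
  _⁻¹ : ℝ → ℝ
  x ⁻¹ with x ≟ 0#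
  ... | yes _  = 0#
  ... | no x≉0 = proj₁ (inverse x≉0)

  infixl 7 _/_
  _/_ : ℝ → ℝ → ℝ
  x / y = x * y ⁻¹

  ∣_∣ : ℝ → ℝ
  ∣ x ∣ with compare x 0#
  ... | tri< _ _ _ = - x
  ... | tri≈ _ _ _ = x
  ... | tri> _ _ _ = x

  IsSqrt : ℝ → ℝ → Set _
  IsSqrt x q = 0# ≤ q × q * q ≈ x

  _⟶_ : (ℕ → ℝ) → ℝ → Set _
  a ⟶ l = ∀ ε → 0# < ε → ∃[ N ] ∀ n → N ℕ.≤ n → ∣ a n - l ∣ < ε

  infix 6 _+i_
  record ℂ : Set c where
    constructor _+i_
    field
      re im : ℝ

  open ℂ public

  infix 4 _≈ᶜ_
  _≈ᶜ_ : Rel ℂ ℓ₁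
  z ≈ᶜ w = re z ≈ re w × im z ≈ im w

  infixl 6 _+ᶜ_
  _+ᶜ_ : Op₂ ℂ
  z +ᶜ w = (re z + re w) +i (im z + im w)

  infixl 7 _*ᶜ_
  _*ᶜ_ : Op₂ ℂ
  z *ᶜ w = (re z * re w - im z * im w) +i (re z * im w + im z * re w)

  0ᶜ 1ᶜ : ℂ
  0ᶜ = 0# +i 0#
  1ᶜ = 1# +i 0#

  ℂ-commutativeRing : CommutativeRing c ℓ₁
  ℂ-commutativeRing = record
    { Carrier = ℂ
    ; _≈_ = _≈ᶜ_
    ; _+_ = _+ᶜ_
    ; _*_ = _*ᶜ_
    ; -_  = λ z → (- re z) +i (- im z)
    ; 0#  = 0ᶜ
    ; 1#  = 1ᶜ
    ; isCommutativeRing = record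
      { isRing = record
        { +-isAbelianGroup = record
          { isGroup = record
            { isMonoid = record
              { isSemigroup = record
                { isMagma = record
                  { isEquivalence = record
                    { refl  = refl , refl
                    ; sym   = λ (p , q) → sym p , sym q
                    ; trans = λ (p , q) (r , s) → trans p r , trans q s
                    }
                  ; ∙-cong = λ (p , q) (r , s) → +-cong p r , +-cong q s
                  }
                ; assoc = λ _ _ _ → +-assoc _ _ _ , +-assoc _ _ _
                }
              ; identity = (λ _ → +-identityˡ _ , +-identityˡ _)
                         , (λ _ → +-identityʳ _ , +-identityʳ _)
              }
            ; inverse = (λ _ → -‿inverseˡ _ , -‿inverseˡ _)
                      , (λ _ → -‿inverseʳ _ , -‿inverseʳ _)
            ; ⁻¹-cong = λ (p , q) → -‿cong p , -‿cong q
            }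
          ; comm = λ _ _ → +-comm _ _ , +-comm _ _
          }
        ; *-cong = λ (p , q) (r , s) →
            +-cong (*-cong p r) (-‿cong (*-cong q s)) ,
            +-cong (*-cong p s) (*-cong q r)
        ; *-assoc = *ᶜ-assoc
        ; *-identity = *ᶜ-identityˡ , λ z → ≈ᶜ-trans (*ᶜ-comm z _) (*ᶜ-identityˡ z)
        ; distrib = *ᶜ-distribˡ , *ᶜ-distribʳ
        }
      ; *-comm = *ᶜ-comm
      }
    }
    where
    acr : AlmostCommutativeRing c ℓ₁
    acr = fromCommutativeRing commutativeRing (λ _ → nothing)

    ≈ᶜ-trans : ∀ {x y z} → x ≈ᶜ y → y ≈ᶜ z → x ≈ᶜ z
    ≈ᶜ-trans (p , q) (r , s) = trans p r , trans q s

    open RingProperties ring using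
      (-0#≈0#; -‿+-comm; x[y-z]≈xy-xz; [y-z]x≈yx-zx)
    open SetoidReasoning setoid
    open RingSolver acr using (_⊕_; _⊗_; ⊝_) renaming (solve to by-ring)

    *ᶜ-comm : ∀ z w → z *ᶜ w ≈ᶜ w *ᶜ z
    *ᶜ-comm (a +i b) (x +i y) =
      by-ring 4 (λ a b x y → a ⊗ x ⊕ ⊝ (b ⊗ y) , x ⊗ a ⊕ ⊝ (y ⊗ b)) refl a b x y ,
      by-ring 4 (λ a b x y → a ⊗ y ⊕ b ⊗ x , x ⊗ b ⊕ y ⊗ a) refl a b x y

    *ᶜ-assoc : ∀ z w u → (z *ᶜ w) *ᶜ u ≈ᶜ z *ᶜ (w *ᶜ u)
    *ᶜ-assoc (a +i b) (x +i y) (s +i t) =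
      (begin
        (a * x - b * y) * s - (a * y + b * x) * t
          ≈⟨ +-cong ([y-z]x≈yx-zx s _ _) (-‿cong (distribʳ t _ _)) ⟩
        (a * x * s - b * y * s) - (a * y * t + b * x * t)
          ≈⟨ +-congˡ (-‿+-comm _ _) ⟨
        (a * x * s - b * y * s) + (- (a * y * t) - b * x * t)
          ≈⟨ by-ring 4 (λ p q u v → (p ⊕ q) ⊕ (u ⊕ v) , (p ⊕ u) ⊕ (v ⊕ q))
               refl _ _ _ _ ⟩
        (a * x * s - a * y * t) + (- (b * x * t) - b * y * s)
          ≈⟨ +-congˡ (-‿+-comm _ _) ⟩
        (a * x * s - a * y * t) - (b * x * t + b * y * s)
          ≈⟨ +-cong (+-cong (*-assoc a x s) (-‿cong (*-assoc a y t)))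
                    (-‿cong (+-cong (*-assoc b x t) (*-assoc b y s))) ⟩
        (a * (x * s) - a * (y * t)) - (b * (x * t) + b * (y * s))
          ≈⟨ +-cong (x[y-z]≈xy-xz a _ _) (-‿cong (distribˡ b _ _)) ⟨
        a * (x * s - y * t) - b * (x * t + y * s) ∎) ,
      (begin
        (a * x - b * y) * t + (a * y + b * x) * s
          ≈⟨ +-cong ([y-z]x≈yx-zx t _ _) (distribʳ s _ _) ⟩
        (a * x * t - b * y * t) + (a * y * s + b * x * s)
          ≈⟨ by-ring 4 (λ p q u v → (p ⊕ q) ⊕ (u ⊕ v) , (p ⊕ u) ⊕ (v ⊕ q))
               refl _ _ _ _ ⟩
        (a * x * t + a * y * s) + (b * x * s - b * y * t)
          ≈⟨ +-cong (+-cong (*-assoc a x t) (*-assoc a y s))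
                    (+-cong (*-assoc b x s) (-‿cong (*-assoc b y t))) ⟩
        (a * (x * t) + a * (y * s)) + (b * (x * s) - b * (y * t))
          ≈⟨ +-cong (distribˡ a _ _) (x[y-z]≈xy-xz b _ _) ⟨
        a * (x * t + y * s) + b * (x * s - y * t) ∎)

    *ᶜ-identityˡ : ∀ z → 1ᶜ *ᶜ z ≈ᶜ z
    *ᶜ-identityˡ (a +i b) =
      trans (+-cong (*-identityˡ a) (trans (-‿cong (zeroˡ b)) -0#≈0#)) (+-identityʳ a) ,
      trans (+-cong (*-identityˡ b) (zeroˡ a)) (+-identityʳ b)

    *ᶜ-distribˡ : ∀ z w u → z *ᶜ (w +ᶜ u) ≈ᶜ (z *ᶜ w) +ᶜ (z *ᶜ u)
    *ᶜ-distribˡ (a +i b) (x +i y) (s +i t) =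
      by-ring 6 (λ a b x y s t →
        a ⊗ (x ⊕ s) ⊕ ⊝ (b ⊗ (y ⊕ t)) ,
        (a ⊗ x ⊕ ⊝ (b ⊗ y)) ⊕ (a ⊗ s ⊕ ⊝ (b ⊗ t))) refl a b x y s t ,
      by-ring 6 (λ a b x y s t →
        a ⊗ (y ⊕ t) ⊕ b ⊗ (x ⊕ s) ,
        (a ⊗ y ⊕ b ⊗ x) ⊕ (a ⊗ t ⊕ b ⊗ s)) refl a b x y s t

    *ᶜ-distribʳ : ∀ z w u → (w +ᶜ u) *ᶜ z ≈ᶜ (w *ᶜ z) +ᶜ (u *ᶜ z)
    *ᶜ-distribʳ (a +i b) (x +i y) (s +i t) =
      by-ring 6 (λ a b x y s t →
        (x ⊕ s) ⊗ a ⊕ ⊝ ((y ⊕ t) ⊗ b) ,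
        (x ⊗ a ⊕ ⊝ (y ⊗ b)) ⊕ (s ⊗ a ⊕ ⊝ (t ⊗ b))) refl a b x y s t ,
      by-ring 6 (λ a b x y s t →
        (x ⊕ s) ⊗ b ⊕ (y ⊕ t) ⊗ a ,
        (x ⊗ b ⊕ y ⊗ a) ⊕ (s ⊗ b ⊕ t ⊗ a)) refl a b x y s t

  module ℂ-ring = CommutativeRing ℂ-commutativeRing
  open Sum ℂ-ring.semiring using (sum; sum-syntax; sum-cong-≋; sum-permute; *-distribˡ-sum)
  open Exp ℂ-ring.commutativeSemiring using () renaming
    (_^_ to _^ᶜ_; ^-homo-* to ^ᶜ-homo-*; ^-distrib-* to ^ᶜ-distrib-*; ^-congˡ to ^ᶜ-congˡ)

  ofReal : ℝ → ℂ
  ofReal x = x +i 0#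

  expSum : ℂ → ℕ → ℂ
  expSum z N = ∑[ k < N ] (ofReal (1# / fromℕ (toℕ k !)) *ᶜ z ^ᶜ toℕ k)

  -- The graph of the complex exponential function: w is the sum of the series
  -- Σ zᵏ / k!, convergence in ℂ = ℝ² being convergence of both components.
  IsExp : ℂ → ℂ → Set _
  IsExp z w = ((re ∘ expSum z) ⟶ re w) × ((im ∘ expSum z) ⟶ im w)

  -- The graphs of cosine and sine, the components of e^{ix}.
  IsCos IsSin : ℝ → ℝ → Set _
  IsCos x a = ∃[ b ] IsExp (0# +i x) (a +i b)
  IsSin x b = ∃[ a ] IsExp (0# +i x) (a +i b)

  -- π is the least positive zero of sine.
  IsPi : ℝ → Set _
  IsPi π = 0# < π × IsSin π 0# × (∀ x → 0# < x → x < π → ¬ IsSin x 0#)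

  Sector : ℝ → ℝ → Pred ℂ _
  Sector v θ z = ∃[ ρ ] ∃[ φ ] ∃[ e ]
    0# < ρ × ∣ φ ∣ < θ × IsExp (0# +i φ) e × z ≈ᶜ ofReal v +ᶜ ofReal ρ *ᶜ e

  -- a = cos θ, s = sin θ, and q is the square root in the upper bound for |y|.
  Lens : ℝ → ℝ → Pred ℂ _
  Lens v θ (x +i y) = ∃[ a ] ∃[ s ] ∃[ q ]
    IsCos θ a × IsSin θ s ×
    IsSqrt (1# / (fromℕ 4 * v ^ 2 * s ^ 2) - (x - 1# / (fromℕ 2 * v)) ^ 2) q ×
    0# < x × x < 1# / v ×
    ∣ y ∣ < (- 1#) / (fromℕ 2 * v * (s / a)) + q

  -- Polynomials of formal degree n; the i-th entry is the coefficient of Xⁱ.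
  Polynomial : ℕ → Set c
  Polynomial n = Vector ℝ (suc n)

  eval : ∀ {n} → Polynomial n → ℂ → ℂ
  eval {n} f z = ∑[ i < suc n ] (ofReal (f i) *ᶜ z ^ᶜ toℕ i)

  IsRoot : ∀ {n} → Polynomial n → Pred ℂ ℓ₁
  IsRoot f z = eval f z ≈ᶜ 0ᶜ

  -- Xⁿ f(1/X), as witnessed by eval-reciprocal.
  reciprocal : ∀ {n} → Polynomial n → Polynomial n
  reciprocal f = Vector.reverse f

  eval-reciprocal : ∀ {n} (f : Polynomial n) {z w} → z *ᶜ w ≈ᶜ 1ᶜ →
                    eval (reciprocal f) z ≈ᶜ z ^ᶜ n *ᶜ eval f w
  eval-reciprocal {n} f {z} {w} zw≈1 = begin
    ∑[ i < suc n ] (ofReal (f (opposite i)) *ᶜ z ^ᶜ toℕ i)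
      ≈⟨ sum-cong-≋ (λ i → term (ofReal (f (opposite i))) (toℕ i) (toℕ (opposite i)) (i+i′≡n i)) ⟩
    ∑[ i < suc n ] (z ^ᶜ n *ᶜ (ofReal (f (opposite i)) *ᶜ w ^ᶜ toℕ (opposite i)))
      ≈⟨ sum-permute (λ i → z ^ᶜ n *ᶜ (ofReal (f i) *ᶜ w ^ᶜ toℕ i)) reverse ⟨
    ∑[ i < suc n ] (z ^ᶜ n *ᶜ (ofReal (f i) *ᶜ w ^ᶜ toℕ i))
      ≈⟨ *-distribˡ-sum (z ^ᶜ n) (λ i → ofReal (f i) *ᶜ w ^ᶜ toℕ i) ⟨
    z ^ᶜ n *ᶜ eval f w ∎
    where
    open SetoidReasoning ℂ-ring.setoid
    open ℂ-ring using () renaming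
      (*-congˡ to *ᶜ-congˡ; *-assoc to *ᶜ-assoc; *-comm to *ᶜ-comm; *-identityʳ to *ᶜ-identityʳ)

    i+i′≡n : (i : Fin (suc n)) → toℕ i ℕ.+ toℕ (opposite i) ≡ n
    i+i′≡n i = ≡.trans (≡.cong (toℕ i ℕ.+_) (opposite-prop i))
                       (ℕ.m+[n∸m]≡n (ℕ.≤-pred (toℕ<n i)))

    1^ : ∀ m → 1ᶜ ^ᶜ m ≈ᶜ 1ᶜ
    1^ zero    = ℂ-ring.refl
    1^ (suc m) = ℂ-ring.trans (ℂ-ring.*-identityˡ _) (1^ m)

    term : ∀ a i j → i ℕ.+ j ≡ n → a *ᶜ z ^ᶜ i ≈ᶜ z ^ᶜ n *ᶜ (a *ᶜ w ^ᶜ j)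
    term a i j ≡.refl = ℂ-ring.sym (begin
      z ^ᶜ (i ℕ.+ j) *ᶜ (a *ᶜ w ^ᶜ j)     ≈⟨ *ᶜ-comm _ _ ⟩
      a *ᶜ w ^ᶜ j *ᶜ z ^ᶜ (i ℕ.+ j)       ≈⟨ *ᶜ-assoc _ _ _ ⟩
      a *ᶜ (w ^ᶜ j *ᶜ z ^ᶜ (i ℕ.+ j))     ≈⟨ *ᶜ-congˡ (*ᶜ-congˡ (^ᶜ-homo-* z i j)) ⟩
      a *ᶜ (w ^ᶜ j *ᶜ (z ^ᶜ i *ᶜ z ^ᶜ j)) ≈⟨ *ᶜ-congˡ (*ᶜ-comm _ _) ⟩
      a *ᶜ (z ^ᶜ i *ᶜ z ^ᶜ j *ᶜ w ^ᶜ j)   ≈⟨ *ᶜ-congˡ (*ᶜ-assoc _ _ _) ⟩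
      a *ᶜ (z ^ᶜ i *ᶜ (z ^ᶜ j *ᶜ w ^ᶜ j)) ≈⟨ *ᶜ-congˡ (*ᶜ-congˡ (^ᶜ-distrib-* z w j)) ⟨
      a *ᶜ (z ^ᶜ i *ᶜ (z *ᶜ w) ^ᶜ j)      ≈⟨ *ᶜ-congˡ (*ᶜ-congˡ (^ᶜ-congˡ j zw≈1)) ⟩
      a *ᶜ (z ^ᶜ i *ᶜ 1ᶜ ^ᶜ j)            ≈⟨ *ᶜ-congˡ (*ᶜ-congˡ (1^ j)) ⟩
      a *ᶜ (z ^ᶜ i *ᶜ 1ᶜ)                 ≈⟨ *ᶜ-congˡ (*ᶜ-identityʳ _) ⟩
      a *ᶜ z ^ᶜ i                         ∎)

module Submission where

open import Defs
open import Algebra.Bundles using (CommutativeRing)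
import Algebra.Properties.AbelianGroup as AbelianGroupProperties
import Algebra.Properties.CommutativeSemiring.Binomial as Binomial
import Algebra.Properties.CommutativeSemiring.Exp as Exp
import Algebra.Properties.Ring as RingProperties
import Algebra.Properties.Semiring.Mult as Mult
import Algebra.Properties.Semiring.Sum as Sum
import Algebra.Solver.Ring as RingSolver
open import Algebra.Solver.Ring.AlmostCommutativeRing
  using (fromCommutativeRing; Induced-equivalence; _-Raw-AlmostCommutative⟶_)
open import Data.Empty using (⊥-elim)
open import Data.Fin.Base using (toℕ)
open import Data.Fin.Properties using (toℕ-fromℕ; toℕ-inject₁; toℕ<n)
open import Data.Integer.Base as ℤ using (ℤ; +_; -[1+_]; _⊖_; _◃_)
import Data.Integer.Properties as ℤ
open import Data.Maybe.Base using (map)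
open import Data.Nat.Base as ℕ using (ℕ; zero; suc; _!; _∸_)
open import Data.Nat.Combinatorics using (_C_; nCk≡n!/k![n-k]!; k![n∸k]!∣n!)
open import Data.Nat.DivMod using (m/n*n≡m)
import Data.Nat.Properties as ℕ
open import Data.Product.Base using (∃-syntax; _×_; _,_; proj₁; proj₂)
open import Data.Sign.Base using (Sign)
open import Data.Sum.Base using (_⊎_; inj₁; inj₂)
open import Data.Vec.Functional using (last)
open import Function.Base using (_∘_)
open import Level using (Lift; lift; _⊔_)
open import Relation.Binary.Bundles using (StrictPartialOrder)
open import Relation.Binary.Consequences using (dec⇒weaklyDec)
open import Relation.Binary.Definitions using (WeaklyDecidable; tri<; tri≈; tri>)
open import Relation.Binary.PropositionalEquality.Core as ≡ using (_≡_)
import Relation.Binary.Reasoning.Setoid as SetoidReasoning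
import Relation.Binary.Reasoning.StrictPartialOrder as OrderReasoning
open import Relation.Binary.Structures using (IsStrictTotalOrder)
open import Relation.Nullary using (¬_; yes; no)
open import Relation.Unary using (_∈_)

-- If z lies in the lens then w = 1/z is a root of the reciprocal, so it suffices
-- that w lies in the sector.  With θ = π/n and w - v = X + iY, squaring the bound
-- on |y| and using sin² θ + cos² θ = 1 turns the lens condition into
-- |Y| cos θ < X sin θ.  The angle of X + iY comes from the intermediate value
-- theorem applied to t ↦ X sin t - Y cos t on [-θ, θ].  All facts about cos and sin
-- follow from exp (z + w) = exp z exp w and |exp z - 1 - z| ≤ |z|² for small z;
-- sin > 0 on (0, π) because sin is positive near 0 and has no zero before π, and
-- cos θ > 0 because sin 2θ = 2 sin θ cos θ with 2θ < π.

-- The shape of the lens comes from inversion. The map `z ↦ 1/z` sends the two lines through `v`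
-- that make the angles `θ` and `-θ` with the real axis to circles through `0` and `1/v`, with
-- centres `1/(2v) ± i cot θ/(2v)` and radius `1/(2v sin θ)`. The lens is the common part of the two
-- discs. Without denominators it reads `v (x² + y²) + |y| cot θ < x`, and division by `x² + y²`
-- yields the cone condition on `1/z - v`. Here `cot θ > 0` matters, which is why `n ≥ 3`, that is
-- `2θ < π`, is used. The length is due to the axioms: the reals are any complete ordered field,
-- cosine and sine are components of a limit, and `π` is only the least positive zero of sine.
-- Membership in the sector asks for an actual angle, so one has to be constructed. The analytic
-- core is the addition theorem: the product of two `n`-th partial sums is compared with the `n`-th
-- partial sum at `z + w`, and the error is at most `A (2n) - A n`, where `A` are the partial sums
-- of the real exponential series at `‖z‖ + ‖w‖`.

-- An abstract ring has no decidable equality, so only integer coefficients let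
-- the solver cancel terms and compute with numerals.
module IntegerCoefficients {c ℓ} (K : CommutativeRing c ℓ) where
  open CommutativeRing K
  open RingProperties ring using (-0#≈0#; -‿distribˡ-*; -‿distribʳ-*; -‿involutive)
  open AbelianGroupProperties +-abelianGroup using (⁻¹-∙-comm)
  open Mult semiring using (×-homo-+; ×1-homo-*) renaming (_×_ to _·_)
  open SetoidReasoning setoid

  -- For `ℝ`, `⟦ + n ⟧` unfolds to the same term as `fromℕ n`, so `con (+ n)` in a solver call
  -- matches the numerals `fromℕ n` of the statement. On the other hand `con (+ 1)` denotes
  -- `1# + 0#`; a literal `1#` therefore enters solver calls as a variable, or is adjusted by an
  -- identity law first.
  ⟦_⟧ : ℤ → Carrier
  ⟦ + n ⟧      = n · 1#
  ⟦ -[1+ n ] ⟧ = - (suc n · 1#)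

  ⟦⟧-⊖ : ∀ m n → ⟦ m ⊖ n ⟧ ≈ m · 1# - n · 1#
  ⟦⟧-⊖ m zero = sym (trans (+-congˡ -0#≈0#) (+-identityʳ _))
  ⟦⟧-⊖ zero (suc n) = sym (+-identityˡ _)
  ⟦⟧-⊖ (suc m) (suc n) = begin
    ⟦ suc m ⊖ suc n ⟧                      ≡⟨ ≡.cong ⟦_⟧ (ℤ.[1+m]⊖[1+n]≡m⊖n m n) ⟩
    ⟦ m ⊖ n ⟧                              ≈⟨ ⟦⟧-⊖ m n ⟩
    m · 1# - n · 1#                        ≈⟨ +-congʳ (+-identityˡ _) ⟨
    0# + m · 1# - n · 1#                   ≈⟨ +-congʳ (+-congʳ (-‿inverseʳ 1#)) ⟨
    1# - 1# + m · 1# - n · 1#              ≈⟨ +-congʳ (+-assoc _ _ _) ⟩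
    1# + (- 1# + m · 1#) - n · 1#          ≈⟨ +-congʳ (+-congˡ (+-comm _ _)) ⟩
    1# + (m · 1# - 1#) - n · 1#            ≈⟨ +-congʳ (+-assoc _ _ _) ⟨
    suc m · 1# - 1# - n · 1#               ≈⟨ +-assoc _ _ _ ⟩
    suc m · 1# + (- 1# - n · 1#)           ≈⟨ +-congˡ (⁻¹-∙-comm _ _) ⟩
    suc m · 1# - suc n · 1#                ∎

  ⟦⟧-◃ : ∀ n → ⟦ Sign.- ◃ n ⟧ ≈ - (n · 1#)
  ⟦⟧-◃ zero    = sym -0#≈0#
  ⟦⟧-◃ (suc n) = refl

  ⟦⟧-homo-+ : ∀ i j → ⟦ i ℤ.+ j ⟧ ≈ ⟦ i ⟧ + ⟦ j ⟧
  ⟦⟧-homo-+ (+ m) (+ n) = ×-homo-+ 1# m n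
  ⟦⟧-homo-+ (+ m) -[1+ n ] = ⟦⟧-⊖ m (suc n)
  ⟦⟧-homo-+ -[1+ m ] (+ n) = trans (⟦⟧-⊖ n (suc m)) (+-comm _ _)
  ⟦⟧-homo-+ -[1+ m ] -[1+ n ] = begin
    - (1# + (1# + (m ℕ.+ n) · 1#))         ≈⟨ -‿cong (+-congˡ (+-congˡ (×-homo-+ 1# m n))) ⟩
    - (1# + (1# + (m · 1# + n · 1#)))      ≈⟨ -‿cong (+-congˡ (+-assoc _ _ _)) ⟨
    - (1# + (suc m · 1# + n · 1#))         ≈⟨ -‿cong (+-congˡ (+-comm _ _)) ⟩
    - (1# + (n · 1# + suc m · 1#))         ≈⟨ -‿cong (+-assoc _ _ _) ⟨
    - (suc n · 1# + suc m · 1#)            ≈⟨ -‿cong (+-comm _ _) ⟩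
    - (suc m · 1# + suc n · 1#)            ≈⟨ ⁻¹-∙-comm _ _ ⟨
    - (suc m · 1#) - suc n · 1#            ∎

  ⟦⟧-homo-* : ∀ i j → ⟦ i ℤ.* j ⟧ ≈ ⟦ i ⟧ * ⟦ j ⟧
  ⟦⟧-homo-* (+ m) (+ n) = begin
    ⟦ Sign.+ ◃ (m ℕ.* n) ⟧                 ≡⟨ ≡.cong ⟦_⟧ (ℤ.+◃n≡+n (m ℕ.* n)) ⟩
    (m ℕ.* n) · 1#                         ≈⟨ ×1-homo-* m n ⟩
    m · 1# * (n · 1#)                      ∎
  ⟦⟧-homo-* (+ m) -[1+ n ] = begin
    ⟦ Sign.- ◃ (m ℕ.* suc n) ⟧             ≈⟨ ⟦⟧-◃ (m ℕ.* suc n) ⟩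
    - ((m ℕ.* suc n) · 1#)                 ≈⟨ -‿cong (×1-homo-* m (suc n)) ⟩
    - (m · 1# * (suc n · 1#))              ≈⟨ -‿distribʳ-* _ _ ⟩
    m · 1# * - (suc n · 1#)                ∎
  ⟦⟧-homo-* -[1+ m ] (+ n) = begin
    ⟦ Sign.- ◃ (suc m ℕ.* n) ⟧             ≈⟨ ⟦⟧-◃ (suc m ℕ.* n) ⟩
    - ((suc m ℕ.* n) · 1#)                 ≈⟨ -‿cong (×1-homo-* (suc m) n) ⟩
    - (suc m · 1# * (n · 1#))              ≈⟨ -‿distribˡ-* _ _ ⟩
    - (suc m · 1#) * (n · 1#)              ∎
  ⟦⟧-homo-* -[1+ m ] -[1+ n ] = begin
    (suc m ℕ.* suc n) · 1#                 ≈⟨ ×1-homo-* (suc m) (suc n) ⟩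
    suc m · 1# * (suc n · 1#)              ≈⟨ -‿involutive _ ⟨
    - - (suc m · 1# * (suc n · 1#))        ≈⟨ -‿cong (-‿distribˡ-* _ _) ⟩
    - (- (suc m · 1#) * (suc n · 1#))      ≈⟨ -‿distribʳ-* _ _ ⟩
    - (suc m · 1#) * - (suc n · 1#)        ∎

  ⟦⟧-homo-- : ∀ i → ⟦ ℤ.- i ⟧ ≈ - ⟦ i ⟧
  ⟦⟧-homo-- (+ zero)  = sym -0#≈0#
  ⟦⟧-homo-- (+ suc n) = refl
  ⟦⟧-homo-- -[1+ n ]  = sym (-‿involutive _)

  morphism : ℤ.+-*-rawRing -Raw-AlmostCommutative⟶ fromCommutativeRing K
  morphism = record
    { ⟦_⟧    = ⟦_⟧
    ; +-homo = ⟦⟧-homo-+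
    ; *-homo = ⟦⟧-homo-*
    ; -‿homo = ⟦⟧-homo--
    ; 0-homo = refl
    ; 1-homo = +-identityʳ 1#
    }

  ⟦⟧-≟ : WeaklyDecidable (Induced-equivalence morphism)
  ⟦⟧-≟ i j = map (λ { ≡.refl → refl }) (dec⇒weaklyDec ℤ._≟_ i j)

  open RingSolver ℤ.+-*-rawRing (fromCommutativeRing K) morphism ⟦⟧-≟ public
    using (solve; con; _:+_; _:*_; _:-_; :-_; _:^_; _:=_)

-- Order, inverses and absolute values in an ordered field.

module OrderedField {c ℓ₁ ℓ₂} (R : CompleteOrderedField c ℓ₁ ℓ₂) where
  open CompleteOrderedField R renaming (Carrier to ℝ)
  open Analysis R
  open IntegerCoefficients commutativeRing
  open IsStrictTotalOrder isStrictTotalOrder using (isStrictPartialOrder)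

  strictPartialOrder : StrictPartialOrder c ℓ₁ ℓ₂
  strictPartialOrder = record { isStrictPartialOrder = isStrictPartialOrder }

  module <-Reasoning = OrderReasoning strictPartialOrder
  open <-Reasoning

  <⇒≤ : ∀ {x y} → x < y → x ≤ y
  <⇒≤ = inj₁

  ≈⇒≤ : ∀ {x y} → x ≈ y → x ≤ y
  ≈⇒≤ = inj₂

  ≤-refl : ∀ {x} → x ≤ x
  ≤-refl = inj₂ refl

  ≤-trans : ∀ {x y z} → x ≤ y → y ≤ z → x ≤ z
  ≤-trans {x} {y} {z} p q = begin x ≤⟨ p ⟩ y ≤⟨ q ⟩ z ∎

  ≤-<-trans : ∀ {x y z} → x ≤ y → y < z → x < z
  ≤-<-trans {x} {y} {z} p q = begin-strict x ≤⟨ p ⟩ y <⟨ q ⟩ z ∎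

  <-≤-trans : ∀ {x y z} → x < y → y ≤ z → x < z
  <-≤-trans {x} {y} {z} p q = begin-strict x <⟨ p ⟩ y ≤⟨ q ⟩ z ∎

  ≤-respˡ : ∀ {x y z} → x ≈ y → x ≤ z → y ≤ z
  ≤-respˡ p q = ≤-trans (≈⇒≤ (sym p)) q

  ≤-respʳ : ∀ {x y z} → y ≈ z → x ≤ y → x ≤ z
  ≤-respʳ p q = ≤-trans q (≈⇒≤ p)

  ≤⇒≯ : ∀ {x y} → x ≤ y → ¬ y < x
  ≤⇒≯ p q = <-irrefl refl (≤-<-trans p q)

  ≮⇒≥ : ∀ {x y} → ¬ x < y → y ≤ x
  ≮⇒≥ {x} {y} x≮y with compare x y
  ... | tri< x<y _ _ = ⊥-elim (x≮y x<y)
  ... | tri≈ _ x≈y _ = inj₂ (sym x≈y)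
  ... | tri> _ _ y<x = inj₁ y<x

  <-or-≥ : ∀ x y → x < y ⊎ y ≤ x
  <-or-≥ x y with x <? y
  ... | yes x<y = inj₁ x<y
  ... | no x≮y  = inj₂ (≮⇒≥ x≮y)

  <⇒≉ : ∀ {x y} → x < y → ¬ y ≈ x
  <⇒≉ x<y y≈x = <-irrefl (sym y≈x) x<y

  x<y⇒0<y-x : ∀ {x y} → x < y → 0# < y - x
  x<y⇒0<y-x {x} {y} x<y = begin-strict
    0#       ≈⟨ -‿inverseˡ x ⟨
    - x + x  <⟨ +-monoʳ-< (- x) x<y ⟩
    - x + y  ≈⟨ +-comm _ _ ⟩
    y - x    ∎

  <-by : ∀ {d x y} → 0# < d → d ≈ y - x → x < y
  <-by {d} {x} {y} 0<d d≈ = begin-strict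
    x            ≈⟨ +-identityʳ x ⟨
    x + 0#       <⟨ +-monoʳ-< x 0<d ⟩
    x + d        ≈⟨ +-congˡ d≈ ⟩
    x + (y - x)  ≈⟨ solve 2 (λ x y → x :+ (y :- x) := y) refl x y ⟩
    y            ∎

  x≤y⇒0≤y-x : ∀ {x y} → x ≤ y → 0# ≤ y - x
  x≤y⇒0≤y-x (inj₁ p) = inj₁ (x<y⇒0<y-x p)
  x≤y⇒0≤y-x {x} {y} (inj₂ x≈y) = inj₂ (sym (trans (+-congˡ (-‿cong x≈y)) (-‿inverseʳ y)))

  ≤-by : ∀ {d x y} → 0# ≤ d → d ≈ y - x → x ≤ y
  ≤-by (inj₁ p) d≈ = inj₁ (<-by p d≈)
  ≤-by {d} {x} {y} (inj₂ 0≈d) d≈ = inj₂ (trans (sym (+-identityʳ x))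
    (trans (+-congˡ (trans 0≈d d≈)) (solve 2 (λ x y → x :+ (y :- x) := y) refl x y)))

  +-mono-≤ : ∀ {x y u v} → x ≤ y → u ≤ v → x + u ≤ y + v
  +-mono-≤ {x} {y} {u} {v} (inj₁ p) (inj₁ q) = inj₁ (begin-strict
    x + u <⟨ +-monoʳ-< x q ⟩ x + v ≈⟨ +-comm _ _ ⟩ v + x <⟨ +-monoʳ-< v p ⟩ v + y ≈⟨ +-comm _ _ ⟩ y + v ∎)
  +-mono-≤ {x} {y} {u} {v} (inj₁ p) (inj₂ q) = inj₁ (begin-strict
    x + u ≈⟨ +-congˡ q ⟩ x + v ≈⟨ +-comm _ _ ⟩ v + x <⟨ +-monoʳ-< v p ⟩ v + y ≈⟨ +-comm _ _ ⟩ y + v ∎)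
  +-mono-≤ {x} {y} {u} {v} (inj₂ p) (inj₁ q) = inj₁ (begin-strict
    x + u ≈⟨ +-congʳ p ⟩ y + u <⟨ +-monoʳ-< y q ⟩ y + v ∎)
  +-mono-≤ (inj₂ p) (inj₂ q) = inj₂ (+-cong p q)

  +-mono-<-≤ : ∀ {x y u v} → x < y → u ≤ v → x + u < y + v
  +-mono-<-≤ {x} {y} {u} {v} p q = begin-strict
    x + u ≤⟨ +-mono-≤ ≤-refl q ⟩ x + v ≈⟨ +-comm _ _ ⟩ v + x <⟨ +-monoʳ-< v p ⟩ v + y ≈⟨ +-comm _ _ ⟩ y + v ∎

  +-nonneg : ∀ {x y} → 0# ≤ x → 0# ≤ y → 0# ≤ x + y
  +-nonneg p q = ≤-respˡ (+-identityʳ 0#) (+-mono-≤ p q)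

  +-pos-nonneg : ∀ {x y} → 0# < x → 0# ≤ y → 0# < x + y
  +-pos-nonneg p q = ≤-<-trans (≈⇒≤ (sym (+-identityʳ 0#))) (+-mono-<-≤ p q)

  +-pos : ∀ {x y} → 0# < x → 0# < y → 0# < x + y
  +-pos p q = +-pos-nonneg p (<⇒≤ q)

  *-nonneg : ∀ {x y} → 0# ≤ x → 0# ≤ y → 0# ≤ x * y
  *-nonneg (inj₁ p) (inj₁ q) = inj₁ (*-pos p q)
  *-nonneg (inj₁ p) (inj₂ q) = inj₂ (sym (trans (*-congˡ (sym q)) (zeroʳ _)))
  *-nonneg (inj₂ p) _        = inj₂ (sym (trans (*-congʳ (sym p)) (zeroˡ _)))

  *-monoˡ-≤ : ∀ {x y z} → 0# ≤ z → x ≤ y → z * x ≤ z * y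
  *-monoˡ-≤ {x} {y} {z} 0≤z x≤y = ≤-by (*-nonneg 0≤z (x≤y⇒0≤y-x x≤y))
    (solve 3 (λ x y z → z :* (y :- x) := z :* y :- z :* x) refl x y z)

  *-mono-≤ : ∀ {x y u v} → 0# ≤ x → 0# ≤ v → x ≤ y → u ≤ v → x * u ≤ y * v
  *-mono-≤ {x} {y} {u} {v} 0≤x 0≤v x≤y u≤v = begin
    x * u  ≤⟨ *-monoˡ-≤ 0≤x u≤v ⟩
    x * v  ≈⟨ *-comm x v ⟩
    v * x  ≤⟨ *-monoˡ-≤ 0≤v x≤y ⟩
    v * y  ≈⟨ *-comm v y ⟩
    y * v  ∎

  neg-pos : ∀ {x} → x < 0# → 0# < - x
  neg-pos {x} x<0 = <-respʳ-≈ (+-identityˡ (- x)) (x<y⇒0<y-x x<0)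

  square-nonneg : ∀ x → 0# ≤ x * x
  square-nonneg x with <-or-≥ x 0#
  ... | inj₁ x<0 = ≤-respʳ (solve 1 (λ x → :- x :* :- x := x :* x) refl x)
                     (<⇒≤ (*-pos (neg-pos x<0) (neg-pos x<0)))
  ... | inj₂ 0≤x = *-nonneg 0≤x 0≤x

  0<1 : 0# < 1#
  0<1 with square-nonneg 1#
  ... | inj₁ p = <-respʳ-≈ (*-identityˡ 1#) p
  ... | inj₂ p = ⊥-elim (0≉1 (trans p (*-identityˡ 1#)))

  *-cancelˡ-pos : ∀ {x y} → 0# < x → 0# < x * y → 0# < y
  *-cancelˡ-pos {x} {y} 0<x 0<xy with <-or-≥ 0# y
  ... | inj₁ 0<y = 0<y
  ... | inj₂ y≤0 = ⊥-elim (≤⇒≯ (≤-by (*-nonneg (<⇒≤ 0<x) (x≤y⇒0≤y-x y≤0))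
                     (solve 2 (λ x y → x :* (con (+ 0) :- y) := con (+ 0) :- x :* y) refl x y)) 0<xy)

  half-nonneg : ∀ {x} → 0# ≤ x + x → 0# ≤ x
  half-nonneg {x} 0≤2x with <-or-≥ x 0#
  ... | inj₂ 0≤x = 0≤x
  ... | inj₁ x<0 = ⊥-elim (≤⇒≯ 0≤2x (<-respʳ-≈ (+-identityʳ 0#) (+-mono-<-≤ x<0 (<⇒≤ x<0))))

  fromℕ-nonneg : ∀ n → 0# ≤ fromℕ n
  fromℕ-nonneg zero    = ≤-refl
  fromℕ-nonneg (suc n) = +-nonneg (<⇒≤ 0<1) (fromℕ-nonneg n)

  fromℕ-pos : ∀ n .{{_ : ℕ.NonZero n}} → 0# < fromℕ n
  fromℕ-pos (suc n) = +-pos-nonneg 0<1 (fromℕ-nonneg n)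

  *-inverseʳ : ∀ {x} → ¬ x ≈ 0# → x * x ⁻¹ ≈ 1#
  *-inverseʳ {x} x≉0 with x ≟ 0#
  ... | yes x≈0  = ⊥-elim (x≉0 x≈0)
  ... | no  x≉0′ = proj₂ (inverse x≉0′)

  pos⇒x*x⁻¹≈1 : ∀ {x} → 0# < x → x * x ⁻¹ ≈ 1#
  pos⇒x*x⁻¹≈1 0<x = *-inverseʳ (<⇒≉ 0<x)

  ⁻¹-pos : ∀ {x} → 0# < x → 0# < x ⁻¹
  ⁻¹-pos {x} 0<x = *-cancelˡ-pos 0<x (<-respʳ-≈ (sym (pos⇒x*x⁻¹≈1 0<x)) 0<1)

  -- The equations are propositional so that later proofs can `rewrite` the absolute value away
  -- instead of repeating the `with` hidden in `∣_∣`.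
  ∣x∣-cases : ∀ x → (0# ≤ x × ∣ x ∣ ≡ x) ⊎ (x < 0# × ∣ x ∣ ≡ - x)
  ∣x∣-cases x with compare x 0#
  ... | tri< x<0 _ _ = inj₂ (x<0 , ≡.refl)
  ... | tri≈ _ x≈0 _ = inj₁ (inj₂ (sym x≈0) , ≡.refl)
  ... | tri> _ _ 0<x = inj₁ (inj₁ 0<x , ≡.refl)

  ∣∣-nonneg : ∀ x → 0# ≤ ∣ x ∣
  ∣∣-nonneg x with ∣x∣-cases x
  ... | inj₁ (0≤x , eq) rewrite eq = 0≤x
  ... | inj₂ (x<0 , eq) rewrite eq = <⇒≤ (neg-pos x<0)

  x≤∣x∣ : ∀ x → x ≤ ∣ x ∣
  x≤∣x∣ x with ∣x∣-cases x
  ... | inj₁ (_   , eq) rewrite eq = ≤-refl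
  ... | inj₂ (x<0 , eq) rewrite eq = <⇒≤ (<-trans x<0 (neg-pos x<0))

  -x≤∣x∣ : ∀ x → - x ≤ ∣ x ∣
  -x≤∣x∣ x with ∣x∣-cases x
  ... | inj₁ (0≤x , eq) rewrite eq =
    ≤-by (+-nonneg 0≤x 0≤x) (solve 1 (λ x → x :+ x := x :- :- x) refl x)
  ... | inj₂ (_   , eq) rewrite eq = ≤-refl

  ∣∣-lub : ∀ {x b} → x ≤ b → - x ≤ b → ∣ x ∣ ≤ b
  ∣∣-lub {x} p q with ∣x∣-cases x
  ... | inj₁ (_ , eq) rewrite eq = p
  ... | inj₂ (_ , eq) rewrite eq = q

  ∣∣-lub-< : ∀ {x b} → x < b → - x < b → ∣ x ∣ < b
  ∣∣-lub-< {x} p q with ∣x∣-cases x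
  ... | inj₁ (_ , eq) rewrite eq = p
  ... | inj₂ (_ , eq) rewrite eq = q

  ∣∣-cong : ∀ {x y} → x ≈ y → ∣ x ∣ ≤ ∣ y ∣
  ∣∣-cong {x} {y} x≈y = ∣∣-lub (≤-respˡ (sym x≈y) (x≤∣x∣ y)) (≤-respˡ (-‿cong (sym x≈y)) (-x≤∣x∣ y))

  nonneg⇒∣x∣≤x : ∀ {x} → 0# ≤ x → ∣ x ∣ ≤ x
  nonneg⇒∣x∣≤x {x} 0≤x = ∣∣-lub ≤-refl (≤-by (+-nonneg 0≤x 0≤x) (solve 1 (λ x → x :+ x := x :- :- x) refl x))

  ∣-x∣≤∣x∣ : ∀ x → ∣ - x ∣ ≤ ∣ x ∣
  ∣-x∣≤∣x∣ x = ∣∣-lub (-x≤∣x∣ x) (≤-respˡ (solve 1 (λ x → x := :- :- x) refl x) (x≤∣x∣ x))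

  ∣x-y∣≤∣y-x∣ : ∀ x y → ∣ x - y ∣ ≤ ∣ y - x ∣
  ∣x-y∣≤∣y-x∣ x y = ≤-trans (∣∣-cong (solve 2 (λ x y → x :- y := :- (y :- x)) refl x y)) (∣-x∣≤∣x∣ (y - x))

  ∣x+y∣≤∣x∣+∣y∣ : ∀ x y → ∣ x + y ∣ ≤ ∣ x ∣ + ∣ y ∣
  ∣x+y∣≤∣x∣+∣y∣ x y = ∣∣-lub (+-mono-≤ (x≤∣x∣ x) (x≤∣x∣ y))
    (≤-respˡ (solve 2 (λ x y → :- x :+ :- y := :- (x :+ y)) refl x y) (+-mono-≤ (-x≤∣x∣ x) (-x≤∣x∣ y)))

  -- No sign cases occur: with `a = ∣ x ∣` and `b = ∣ y ∣`, the sum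
  -- `(a - x)(b + y) + (a + x)(b - y)` equals `2 (a b - x y)` and consists of products of
  -- nonnegative factors. Changing the sign of `y` gives the bound for `- (x * y)`.
  ∣x*y∣≤∣x∣*∣y∣ : ∀ x y → ∣ x * y ∣ ≤ ∣ x ∣ * ∣ y ∣
  ∣x*y∣≤∣x∣*∣y∣ x y = ∣∣-lub
    (≤-by (half-nonneg (≤-respʳ
      (solve 4 (λ x y a b → (a :- x) :* (b :- :- y) :+ (a :- :- x) :* (b :- y)
                         := (a :* b :- x :* y) :+ (a :* b :- x :* y)) refl x y ∣ x ∣ ∣ y ∣)
      (+-nonneg (*-nonneg 0≤∣x∣-x 0≤∣y∣+y) (*-nonneg 0≤∣x∣+x 0≤∣y∣-y)))) refl)
    (≤-by (half-nonneg (≤-respʳ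
      (solve 4 (λ x y a b → (a :- x) :* (b :- y) :+ (a :- :- x) :* (b :- :- y)
                         := (a :* b :- :- (x :* y)) :+ (a :* b :- :- (x :* y))) refl x y ∣ x ∣ ∣ y ∣)
      (+-nonneg (*-nonneg 0≤∣x∣-x 0≤∣y∣-y) (*-nonneg 0≤∣x∣+x 0≤∣y∣+y)))) refl)
    where
    0≤∣x∣-x : 0# ≤ ∣ x ∣ - x
    0≤∣x∣-x = x≤y⇒0≤y-x (x≤∣x∣ x)
    0≤∣x∣+x : 0# ≤ ∣ x ∣ - - x
    0≤∣x∣+x = x≤y⇒0≤y-x (-x≤∣x∣ x)
    0≤∣y∣-y : 0# ≤ ∣ y ∣ - y
    0≤∣y∣-y = x≤y⇒0≤y-x (x≤∣x∣ y)
    0≤∣y∣+y : 0# ≤ ∣ y ∣ - - y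
    0≤∣y∣+y = x≤y⇒0≤y-x (-x≤∣x∣ y)

-- Limits of real sequences, completeness and the intermediate value theorem.

module Limits {c ℓ₁ ℓ₂} (R : CompleteOrderedField c ℓ₁ ℓ₂) where
  open CompleteOrderedField R renaming (Carrier to ℝ)
  open Analysis R
  open IntegerCoefficients commutativeRing
  open OrderedField R
  open <-Reasoning

  divide-pos : ∀ {x y} → 0# < x → 0# < y → ∃[ z ] 0# < z × y * z ≈ x
  divide-pos {x} {y} 0<x 0<y = x * y ⁻¹ , *-pos 0<x (⁻¹-pos 0<y) , (begin-equality
    y * (x * y ⁻¹)  ≈⟨ solve 3 (λ x y z → y :* (x :* z) := x :* (y :* z)) refl x y (y ⁻¹) ⟩
    x * (y * y ⁻¹)  ≈⟨ *-congˡ (pos⇒x*x⁻¹≈1 0<y) ⟩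
    x * 1#          ≈⟨ *-identityʳ x ⟩
    x               ∎)

  halve : ∀ {ε} → 0# < ε → ∃[ δ ] 0# < δ × δ + δ ≈ ε
  halve 0<ε with divide-pos 0<ε (fromℕ-pos 2)
  ... | δ , 0<δ , 2δ≈ε = δ , 0<δ , trans (solve 1 (λ d → d :+ d := con (+ 2) :* d) refl δ) 2δ≈ε

  common-lower-bound : ∀ {x y} → 0# < x → 0# < y → ∃[ δ ] 0# < δ × δ ≤ x × δ ≤ y
  common-lower-bound {x} {y} 0<x 0<y with <-or-≥ x y
  ... | inj₁ x<y = x , 0<x , ≤-refl , <⇒≤ x<y
  ... | inj₂ y≤x = y , 0<y , y≤x , ≤-refl

  ∣x-y∣-triangle : ∀ x y z → ∣ x - z ∣ ≤ ∣ x - y ∣ + ∣ y - z ∣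
  ∣x-y∣-triangle x y z = ≤-trans
    (∣∣-cong (solve 3 (λ x y z → x :- z := (x :- y) :+ (y :- z)) refl x y z)) (∣x+y∣≤∣x∣+∣y∣ _ _)

  ∣x-y∣<ε⇒x<y+ε : ∀ {x y ε} → ∣ x - y ∣ < ε → x < y + ε
  ∣x-y∣<ε⇒x<y+ε {x} {y} {ε} p = <-by (x<y⇒0<y-x (≤-<-trans (x≤∣x∣ (x - y)) p))
    (solve 3 (λ x y e → e :- (x :- y) := y :+ e :- x) refl x y ε)

  ∣x-y∣<ε⇒y<x+ε : ∀ {x y ε} → ∣ x - y ∣ < ε → y < x + ε
  ∣x-y∣<ε⇒y<x+ε {x} {y} p = ∣x-y∣<ε⇒x<y+ε (≤-<-trans (∣x-y∣≤∣y-x∣ y x) p)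

  ∣x-y∣<ε : ∀ {x y ε} → x < y + ε → y < x + ε → ∣ x - y ∣ < ε
  ∣x-y∣<ε {x} {y} {ε} p q = ∣∣-lub-<
    (<-by (x<y⇒0<y-x p) (solve 3 (λ x y e → y :+ e :- x := e :- (x :- y)) refl x y ε))
    (<-by (x<y⇒0<y-x q) (solve 3 (λ x y e → x :+ e :- y := e :- :- (x :- y)) refl x y ε))

  ∣x-y∣≤b⇒x≤y+b : ∀ {x y b} → ∣ x - y ∣ ≤ b → x ≤ y + b
  ∣x-y∣≤b⇒x≤y+b {x} {y} {b} p = ≤-by (x≤y⇒0≤y-x (≤-trans (x≤∣x∣ (x - y)) p))
    (solve 3 (λ x y e → e :- (x :- y) := y :+ e :- x) refl x y b)

  ∣x-y∣≤b⇒y≤x+b : ∀ {x y b} → ∣ x - y ∣ ≤ b → y ≤ x + b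
  ∣x-y∣≤b⇒y≤x+b {x} {y} p = ∣x-y∣≤b⇒x≤y+b (≤-trans (∣x-y∣≤∣y-x∣ y x) p)

  ∣x-y∣≤b : ∀ {x y b} → x ≤ y + b → y ≤ x + b → ∣ x - y ∣ ≤ b
  ∣x-y∣≤b {x} {y} {b} p q = ∣∣-lub
    (≤-by (x≤y⇒0≤y-x p) (solve 3 (λ x y e → y :+ e :- x := e :- (x :- y)) refl x y b))
    (≤-by (x≤y⇒0≤y-x q) (solve 3 (λ x y e → x :+ e :- y := e :- :- (x :- y)) refl x y b))

  arbitrarily-close⇒≈ : ∀ {x y} → (∀ ε → 0# < ε → ∣ x - y ∣ < ε) → x ≈ y
  arbitrarily-close⇒≈ {x} {y} close with compare x y
  ... | tri≈ _ x≈y _ = x≈y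
  ... | tri< x<y _ _ = ⊥-elim (<-irrefl (solve 2 (λ x y → y := x :+ (y :- x)) refl x y)
                         (∣x-y∣<ε⇒y<x+ε (close (y - x) (x<y⇒0<y-x x<y))))
  ... | tri> _ _ y<x = ⊥-elim (<-irrefl (solve 2 (λ x y → x := y :+ (x :- y)) refl x y)
                         (∣x-y∣<ε⇒x<y+ε (close (x - y) (x<y⇒0<y-x y<x))))

  ⟶-cong : ∀ {u v l m} → (∀ n → u n ≈ v n) → l ≈ m → u ⟶ l → v ⟶ m
  ⟶-cong u≈v l≈m u⟶l ε 0<ε with u⟶l ε 0<ε
  ... | N , close = N , λ n N≤n →
    ≤-<-trans (∣∣-cong (+-cong (sym (u≈v n)) (-‿cong (sym l≈m)))) (close n N≤n)

  ⟶-unique : ∀ {u l m} → u ⟶ l → u ⟶ m → l ≈ m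
  ⟶-unique {u} {l} {m} u⟶l u⟶m = arbitrarily-close⇒≈ λ ε 0<ε →
    let δ , 0<δ , 2δ≈ε = halve 0<ε
        M , closeM = u⟶l δ 0<δ
        N , closeN = u⟶m δ 0<δ
        k = M ℕ.⊔ N
    in begin-strict
      ∣ l - m ∣                    ≤⟨ ∣x-y∣-triangle l (u k) m ⟩
      ∣ l - u k ∣ + ∣ u k - m ∣    <⟨ +-mono-<-≤ (≤-<-trans (∣x-y∣≤∣y-x∣ l (u k)) (closeM k (ℕ.m≤m⊔n M N)))
                                                 (<⇒≤ (closeN k (ℕ.m≤n⊔m M N))) ⟩
      δ + δ                        ≈⟨ 2δ≈ε ⟩
      ε                            ∎

  ⟶-subsequence : ∀ {u l} {φ : ℕ → ℕ} → (∀ n → n ℕ.≤ φ n) → u ⟶ l → (u ∘ φ) ⟶ l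
  ⟶-subsequence n≤φn u⟶l ε 0<ε with u⟶l ε 0<ε
  ... | N , close = N , λ n N≤n → close _ (ℕ.≤-trans N≤n (n≤φn n))

  ⟶-squeeze : ∀ {u v l} → (∀ n → ∣ u n - l ∣ ≤ v n) → v ⟶ 0# → u ⟶ l
  ⟶-squeeze {u} {v} {l} bound v⟶0 ε 0<ε with v⟶0 ε 0<ε
  ... | N , close = N , λ n N≤n → begin-strict
    ∣ u n - l ∣  ≤⟨ bound n ⟩
    v n          <⟨ ∣x-y∣<ε⇒x<y+ε (close n N≤n) ⟩
    0# + ε       ≈⟨ +-identityˡ ε ⟩
    ε            ∎

  ⟶-neg : ∀ {u l} → u ⟶ l → (λ n → - u n) ⟶ (- l)
  ⟶-neg {u} {l} u⟶l ε 0<ε with u⟶l ε 0<ε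
  ... | N , close = N , λ n N≤n → begin-strict
    ∣ - u n - - l ∣  ≤⟨ ∣∣-cong (solve 2 (λ x y → :- x :- :- y := y :- x) refl (u n) l) ⟩
    ∣ l - u n ∣      ≤⟨ ∣x-y∣≤∣y-x∣ l (u n) ⟩
    ∣ u n - l ∣      <⟨ close n N≤n ⟩
    ε                ∎

  ⟶-+ : ∀ {u v l m} → u ⟶ l → v ⟶ m → (λ n → u n + v n) ⟶ (l + m)
  ⟶-+ {u} {v} {l} {m} u⟶l v⟶m ε 0<ε =
    let δ , 0<δ , 2δ≈ε = halve 0<ε
        M , closeM = u⟶l δ 0<δ
        N , closeN = v⟶m δ 0<δ
    in M ℕ.⊔ N , λ n M⊔N≤n → begin-strict
      ∣ u n + v n - (l + m) ∣      ≤⟨ ∣∣-cong (solve 4 (λ x y l m →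
                                       x :+ y :- (l :+ m) := (x :- l) :+ (y :- m)) refl (u n) (v n) l m) ⟩
      ∣ (u n - l) + (v n - m) ∣    ≤⟨ ∣x+y∣≤∣x∣+∣y∣ _ _ ⟩
      ∣ u n - l ∣ + ∣ v n - m ∣    <⟨ +-mono-<-≤ (closeM n (ℕ.m⊔n≤o⇒m≤o M N M⊔N≤n))
                                                 (<⇒≤ (closeN n (ℕ.m⊔n≤o⇒n≤o M N M⊔N≤n))) ⟩
      δ + δ                        ≈⟨ 2δ≈ε ⟩
      ε                            ∎

  ⟶-* : ∀ {u v l m} → u ⟶ l → v ⟶ m → (λ n → u n * v n) ⟶ (l * m)
  ⟶-* {u} {v} {l} {m} u⟶l v⟶m ε 0<ε =
    -- Eventually `∣ v n ∣` is at most `∣ m ∣ + 1#`, so the error is at most `K * δ`. The choice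
    -- `(1# + K) * δ ≈ ε` leaves a spare `δ`, which makes the final bound strict.
    let K = ∣ m ∣ + 1# + ∣ l ∣
        0≤∣m∣+1 = +-nonneg (∣∣-nonneg m) (<⇒≤ 0<1)
        0≤K = +-nonneg 0≤∣m∣+1 (∣∣-nonneg l)
        δ , 0<δ , Kδ≈ε = divide-pos 0<ε (+-pos-nonneg 0<1 0≤K)
        M , closeM = u⟶l δ 0<δ
        N , closeN = v⟶m δ 0<δ
        P , closeP = v⟶m 1# 0<1
        Q = M ℕ.⊔ (N ℕ.⊔ P)
    in Q , λ n Q≤n →
      let N⊔P≤n = ℕ.m⊔n≤o⇒n≤o M (N ℕ.⊔ P) Q≤n
          ∣v∣≤ : ∣ v n ∣ ≤ ∣ m ∣ + 1#
          ∣v∣≤ = begin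
            ∣ v n ∣                ≤⟨ ∣∣-cong (solve 2 (λ y m → y := m :+ (y :- m)) refl (v n) m) ⟩
            ∣ m + (v n - m) ∣      ≤⟨ ∣x+y∣≤∣x∣+∣y∣ _ _ ⟩
            ∣ m ∣ + ∣ v n - m ∣    ≤⟨ +-mono-≤ ≤-refl (<⇒≤ (closeP n (ℕ.m⊔n≤o⇒n≤o N P N⊔P≤n))) ⟩
            ∣ m ∣ + 1#             ∎
      in begin-strict
        ∣ u n * v n - l * m ∣
          ≤⟨ ∣∣-cong (solve 4 (λ x y l m → x :* y :- l :* m := (x :- l) :* y :+ l :* (y :- m))
               refl (u n) (v n) l m) ⟩
        ∣ (u n - l) * v n + l * (v n - m) ∣
          ≤⟨ ∣x+y∣≤∣x∣+∣y∣ _ _ ⟩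
        ∣ (u n - l) * v n ∣ + ∣ l * (v n - m) ∣
          ≤⟨ +-mono-≤ (∣x*y∣≤∣x∣*∣y∣ _ _) (∣x*y∣≤∣x∣*∣y∣ _ _) ⟩
        ∣ u n - l ∣ * ∣ v n ∣ + ∣ l ∣ * ∣ v n - m ∣
          ≤⟨ +-mono-≤ (*-mono-≤ (∣∣-nonneg _) 0≤∣m∣+1 (<⇒≤ (closeM n (ℕ.m⊔n≤o⇒m≤o M (N ℕ.⊔ P) Q≤n))) ∣v∣≤)
                      (*-monoˡ-≤ (∣∣-nonneg l) (<⇒≤ (closeN n (ℕ.m⊔n≤o⇒m≤o N P N⊔P≤n)))) ⟩
        δ * (∣ m ∣ + 1#) + ∣ l ∣ * δ
          <⟨ <-by 0<δ (solve 4 (λ d a o b → d := (con (+ 1) :+ (a :+ o :+ b)) :* d :- (d :* (a :+ o) :+ b :* d))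
               refl δ (∣ m ∣) 1# (∣ l ∣)) ⟩
        (fromℕ 1 + K) * δ
          ≈⟨ *-congʳ (+-congʳ (+-identityʳ 1#)) ⟩
        (1# + K) * δ
          ≈⟨ Kδ≈ε ⟩
        ε ∎

  ⟶-≤ : ∀ {u l b} N → u ⟶ l → (∀ n → N ℕ.≤ n → u n ≤ b) → l ≤ b
  ⟶-≤ {u} {l} {b} N u⟶l bound = ≮⇒≥ λ b<l →
    let M , close = u⟶l (l - b) (x<y⇒0<y-x b<l)
        k = M ℕ.⊔ N
    in <-irrefl (solve 2 (λ l b → l := b :+ (l :- b)) refl l b)
         (<-≤-trans (∣x-y∣<ε⇒y<x+ε (close k (ℕ.m≤m⊔n M N))) (+-mono-≤ (bound k (ℕ.m≤n⊔m M N)) ≤-refl))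

  ⟶-∣-∣≤ : ∀ {u l m b} N → u ⟶ l → (∀ n → N ℕ.≤ n → ∣ u n - m ∣ ≤ b) → ∣ l - m ∣ ≤ b
  ⟶-∣-∣≤ {u} {l} {m} {b} N u⟶l bound = ∣x-y∣≤b
    (⟶-≤ N u⟶l λ n N≤n → ∣x-y∣≤b⇒x≤y+b (bound n N≤n))
    (≤-by (x≤y⇒0≤y-x (⟶-≤ {b = b - m} N (⟶-neg u⟶l) λ n N≤n →
             ≤-by (x≤y⇒0≤y-x (∣x-y∣≤b⇒y≤x+b (bound n N≤n)))
               (solve 3 (λ x m b → x :+ b :- m := b :- m :- :- x) refl (u n) m b)))
          (solve 3 (λ l m b → b :- m :- :- l := l :+ b :- m) refl l m b))

  steps⇒monotone : ∀ {u : ℕ → ℝ} → (∀ n → u n ≤ u (suc n)) → ∀ {m n} → m ℕ.≤ n → u m ≤ u n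
  steps⇒monotone {u} step m≤n = go (ℕ.≤⇒≤′ m≤n)
    where
    go : ∀ {m n} → m ℕ.≤′ n → u m ≤ u n
    go ℕ.≤′-refl       = ≤-refl
    go (ℕ.≤′-step m≤n) = ≤-trans (go m≤n) (step _)

  monotone-convergence : ∀ {u b} → (∀ n → u n ≤ u (suc n)) → (∀ n → u n ≤ b) → ∃[ l ] u ⟶ l
  monotone-convergence {u} {b} step bound
    -- `supremum` accepts predicates at one fixed level only, hence the `Lift`.
    with supremum (λ x → Lift (c ⊔ ℓ₂) (∃[ n ] x ≈ u n)) (u 0 , lift (0 , refl))
           (b , λ { (lift (n , x≈un)) → ≤-respˡ (sym x≈un) (bound n) })
  ... | s , ≤s , exceeds = s , λ ε 0<ε →
    let x , lift (N , x≈uN) , s-ε<x = exceeds {s - ε} (<-by 0<ε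
          (solve 2 (λ s e → e := s :- (s :- e)) refl s ε))
    in N , λ n N≤n →
      let un≤s = ≤s {u n} (lift (n , refl))
      in ∣x-y∣<ε
        (≤-<-trans un≤s (<-by 0<ε (solve 2 (λ s e → e := s :+ e :- s) refl s ε)))
        (begin-strict
          s            ≈⟨ solve 2 (λ s e → s := s :- e :+ e) refl s ε ⟩
          s - ε + ε    <⟨ +-mono-<-≤ s-ε<x ≤-refl ⟩
          x + ε        ≤⟨ +-mono-≤ (≤-respˡ (sym x≈uN) (steps⇒monotone step N≤n)) ≤-refl ⟩
          u n + ε      ∎)

  -- u + A increases and u - A decreases.
  dominated-convergence : ∀ {u A : ℕ → ℝ} {b} → (∀ n → ∣ u (suc n) - u n ∣ ≤ A (suc n) - A n) →
                          (∀ n → A n ≤ b) → ∃[ l ] u ⟶ l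
  dominated-convergence {u} {A} {b} step bound =
    let lA , A⟶lA = monotone-convergence A-step bound
        lS , u+A⟶lS = monotone-convergence {u = λ n → u n + A n} {b = u 0 - A 0 + (b + b)}
          (λ n → ≤-by (x≤y⇒0≤y-x (∣x-y∣≤b⇒y≤x+b (step n)))
            (solve 4 (λ u u′ a a′ → u′ :+ (a′ :- a) :- u := u′ :+ a′ :- (u :+ a)) refl
              (u n) (u (suc n)) (A n) (A (suc n))))
          (λ n → begin
            u n + A n                  ≈⟨ solve 2 (λ u a → u :+ a := u :- a :+ (a :+ a)) refl (u n) (A n) ⟩
            u n - A n + (A n + A n)    ≤⟨ +-mono-≤ (u-A≤ n) (+-mono-≤ (bound n) (bound n)) ⟩
            u 0 - A 0 + (b + b)        ∎)
    in lS - lA , ⟶-cong (λ n → solve 2 (λ u a → u :+ a :- a := u) refl (u n) (A n)) refl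
                   (⟶-+ u+A⟶lS (⟶-neg A⟶lA))
    where
    A-step : ∀ n → A n ≤ A (suc n)
    A-step n = ≤-by (≤-trans (∣∣-nonneg _) (step n)) refl

    u-A≤ : ∀ n → u n - A n ≤ u 0 - A 0
    u-A≤ zero    = ≤-refl
    u-A≤ (suc n) = ≤-trans
      (≤-by (x≤y⇒0≤y-x (∣x-y∣≤b⇒x≤y+b (step n)))
        (solve 4 (λ u u′ a a′ → u :+ (a′ :- a) :- u′ := u :- a :- (u′ :- a′)) refl
          (u n) (u (suc n)) (A n) (A (suc n))))
      (u-A≤ n)

  -- Let `s` be the supremum of the naturals not exceeding `x`. Some natural `n` of this set lies
  -- above `s - 1#`, and its successor is either above `x`, as wanted, or again in the set and above
  -- `s`, which is absurd.
  archimedean : ∀ x → ∃[ n ] x < fromℕ n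
  archimedean x with <-or-≥ x 0#
  ... | inj₁ x<0 = 0 , x<0
  ... | inj₂ 0≤x
    with supremum (λ y → Lift c ((∃[ n ] y ≈ fromℕ n) × y ≤ x)) (0# , lift ((0 , refl) , 0≤x))
           (x , λ { (lift (_ , y≤x)) → y≤x })
  ... | s , ≤s , exceeds
    with exceeds {s - 1#} (<-by 0<1 (solve 2 (λ s o → o := s :- (s :- o)) refl s 1#))
  ... | y , lift ((n , y≈n) , _) , s-1<y with <-or-≥ x (fromℕ (suc n))
  ... | inj₁ x<1+n = suc n , x<1+n
  ... | inj₂ 1+n≤x = ⊥-elim (≤⇒≯ (≤s (lift ((suc n , refl) , 1+n≤x))) (begin-strict
    s            ≈⟨ solve 2 (λ s o → s := o :+ (s :- o)) refl s 1# ⟩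
    1# + (s - 1#)  <⟨ +-monoʳ-< 1# s-1<y ⟩
    1# + y         ≈⟨ +-congˡ y≈n ⟩
    1# + fromℕ n   ∎))

  Continuous : (ℝ → ℝ) → Set (c ⊔ ℓ₂)
  Continuous g = ∀ x ε → 0# < ε → ∃[ δ ] 0# < δ × ∀ y → ∣ y - x ∣ < δ → ∣ g y - g x ∣ < ε

  -- Equal points lie within every `δ` of each other, so continuity already forces equal values.
  -- `intermediate-value` relies on this to separate the zero from the end points.
  continuous⇒cong : ∀ {g} → Continuous g → ∀ {x y} → x ≈ y → g x ≈ g y
  continuous⇒cong {g} cts {x} {y} x≈y = arbitrarily-close⇒≈ λ ε 0<ε →
    let δ , 0<δ , close = cts y ε 0<ε
    in close x (∣x-y∣<ε (≤-<-trans (≈⇒≤ x≈y) (<-by 0<δ (solve 2 (λ y d → d := y :+ d :- y) refl y δ)))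
                        (≤-<-trans (≈⇒≤ (sym x≈y)) (<-by 0<δ (solve 2 (λ x d → d := x :+ d :- x) refl x δ))))

  -- The zero is the supremum `s` of the points of `[α, β]` at which `g` is negative. If `g s < 0`,
  -- negativity persists a little to the right of `s`; if `g s > 0`, positivity keeps the set away
  -- from `s` on the left. Both contradict the choice of `s`.
  intermediate-value : ∀ {g} → Continuous g → ∀ {α β} → α < β → g α < 0# → 0# < g β →
                       ∃[ x ] α < x × x < β × g x ≈ 0#
  intermediate-value {g} cts {α} {β} α<β gα<0 0<gβ
    with supremum (λ x → Lift c (α ≤ x × x ≤ β × g x < 0#)) (α , lift (≤-refl , <⇒≤ α<β , gα<0))
           (β , λ { (lift (_ , x≤β , _)) → x≤β })
  ... | s , ≤s , exceeds = s , α<s , s<β , gs≈0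
    where
    α≤s : α ≤ s
    α≤s = ≤s (lift (≤-refl , <⇒≤ α<β , gα<0))

    s≤β : s ≤ β
    s≤β = ≮⇒≥ λ β<s → let x , lift (_ , x≤β , _) , β<x = exceeds β<s in ≤⇒≯ x≤β β<x

    gs≮0 : ¬ g s < 0#
    gs≮0 gs<0 with cts s (- g s) (neg-pos gs<0)
    ... | δ , 0<δ , close with halve 0<δ
    ... | η , 0<η , 2η≈δ = case-split (<-or-≥ β (s + η))
      where
      s<s+η : s < s + η
      s<s+η = <-by 0<η (solve 2 (λ s e → e := s :+ e :- s) refl s η)
      s+η<s+δ : s + η < s + δ
      s+η<s+δ = <-by 0<η (trans (solve 2 (λ s e → e := s :+ (e :+ e) :- (s :+ e)) refl s η)
                                (+-congʳ (+-congˡ 2η≈δ)))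
      g<0 : ∀ {t} → s ≤ t → t ≤ s + η → g t < 0#
      g<0 {t} s≤t t≤s+η = <-respʳ-≈ (-‿inverseʳ (g s)) (∣x-y∣<ε⇒x<y+ε (close t (∣x-y∣<ε
        (≤-<-trans t≤s+η s+η<s+δ)
        (≤-<-trans s≤t (<-by 0<δ (solve 2 (λ t d → d := t :+ d :- t) refl t δ))))))
      case-split : β < s + η ⊎ s + η ≤ β → _
      -- The step to the right may leave `[α, β]`; then `β` itself lies in the stretch where `g` is
      -- still negative.
      case-split (inj₁ β<s+η) = <-asym 0<gβ (g<0 s≤β (<⇒≤ β<s+η))
      case-split (inj₂ s+η≤β) = ≤⇒≯
        (≤s (lift (≤-trans α≤s (<⇒≤ s<s+η) , s+η≤β , g<0 (<⇒≤ s<s+η) ≤-refl))) s<s+η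

    gs≯0 : ¬ 0# < g s
    gs≯0 0<gs with cts s (g s) 0<gs
    ... | δ , 0<δ , close with exceeds {s - δ} (<-by 0<δ (solve 2 (λ s d → d := s :- (s :- d)) refl s δ))
    ... | x , lift (α≤x , x≤β , gx<0) , s-δ<x = <-asym gx<0 (<-by (x<y⇒0<y-x
        (∣x-y∣<ε⇒y<x+ε (close x (∣x-y∣<ε
          (≤-<-trans (≤s (lift (α≤x , x≤β , gx<0))) (<-by 0<δ (solve 2 (λ s d → d := s :+ d :- s) refl s δ)))
          (<-by (x<y⇒0<y-x s-δ<x) (solve 3 (λ x s d → x :- (s :- d) := x :+ d :- s) refl x s δ))))))
        (solve 2 (λ a b → a :+ b :- b := a :- con (+ 0)) refl (g x) (g s)))

    gs≈0 : g s ≈ 0#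
    gs≈0 with compare (g s) 0#
    ... | tri< gs<0 _ _ = ⊥-elim (gs≮0 gs<0)
    ... | tri≈ _ gs≈0 _ = gs≈0
    ... | tri> _ _ 0<gs = ⊥-elim (gs≯0 0<gs)

    α<s : α < s
    α<s with α≤s
    ... | inj₁ α<s = α<s
    ... | inj₂ α≈s = ⊥-elim (<-irrefl (trans (continuous⇒cong cts α≈s) gs≈0) gα<0)

    s<β : s < β
    s<β with s≤β
    ... | inj₁ s<β = s<β
    ... | inj₂ s≈β = ⊥-elim (<-irrefl (trans (sym gs≈0) (continuous⇒cong cts s≈β)) 0<gβ)

-- Finite sums over initial segments of the natural numbers.

module Summation {c ℓ} (K : CommutativeRing c ℓ) where
  open CommutativeRing K
  open IntegerCoefficients K
  open Sum semiring using (sum; sum-cong-≋; sum-init-last)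
  open SetoidReasoning setoid

  -- Splits off the last summand, whereas `sum` splits off the first. A partial sum of a series thus
  -- unfolds to the preceding one plus a term.
  Σ< : (ℕ → Carrier) → ℕ → Carrier
  Σ< f zero    = 0#
  Σ< f (suc n) = Σ< f n + f n

  sum≈Σ< : ∀ f n → sum {n} (f ∘ toℕ) ≈ Σ< f n
  sum≈Σ< f zero    = refl
  sum≈Σ< f (suc n) = begin
    sum {suc n} (f ∘ toℕ)  ≈⟨ sum-init-last (f ∘ toℕ) ⟩
    _ + _                  ≈⟨ +-cong (sum-cong-≋ {n} λ i → reflexive (≡.cong f (toℕ-inject₁ i)))
                                     (reflexive (≡.cong f (toℕ-fromℕ n))) ⟩
    sum {n} (f ∘ toℕ) + f n  ≈⟨ +-congʳ (sum≈Σ< f n) ⟩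
    Σ< f n + f n             ∎

  Σ<-cong : ∀ {f g} n → (∀ i → i ℕ.< n → f i ≈ g i) → Σ< f n ≈ Σ< g n
  Σ<-cong zero    f≈g = refl
  Σ<-cong (suc n) f≈g = +-cong (Σ<-cong n λ i i<n → f≈g i (ℕ.m<n⇒m<1+n i<n)) (f≈g n (ℕ.n<1+n n))

  Σ<-+ : ∀ f g n → Σ< (λ i → f i + g i) n ≈ Σ< f n + Σ< g n
  Σ<-+ f g zero    = sym (+-identityˡ 0#)
  Σ<-+ f g (suc n) = trans (+-congʳ (Σ<-+ f g n))
    (solve 4 (λ F G a b → F :+ G :+ (a :+ b) := F :+ a :+ (G :+ b)) refl (Σ< f n) (Σ< g n) (f n) (g n))

  Σ<-- : ∀ f g n → Σ< (λ i → f i - g i) n ≈ Σ< f n - Σ< g n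
  Σ<-- f g zero    = sym (-‿inverseʳ 0#)
  Σ<-- f g (suc n) = trans (+-congʳ (Σ<-- f g n))
    (solve 4 (λ F G a b → F :- G :+ (a :- b) := F :+ a :- (G :+ b)) refl (Σ< f n) (Σ< g n) (f n) (g n))

  Σ<-*ʳ : ∀ f y n → Σ< (λ i → f i * y) n ≈ Σ< f n * y
  Σ<-*ʳ f y zero    = sym (zeroˡ y)
  Σ<-*ʳ f y (suc n) = trans (+-congʳ (Σ<-*ʳ f y n)) (sym (distribʳ y _ _))

-- Keeping `1 / n!` abstract lets the same algebra serve twice: over `ℂ` for the series itself and
-- over `ℝ` for the series of norms that dominates it.
InverseFactorials : ∀ {c ℓ} (K : CommutativeRing c ℓ) → (ℕ → CommutativeRing.Carrier K) → Set ℓ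
InverseFactorials K κ = ∀ n → (n !) · 1# * κ n ≈ 1#
  where
  open CommutativeRing K
  open Mult semiring renaming (_×_ to _·_)

-- Partial sums of the exponential series over a commutative ring.

module ExponentialSeries {c ℓ} (K : CommutativeRing c ℓ) (κ : ℕ → CommutativeRing.Carrier K)
                         (n!κₙ≈1 : InverseFactorials K κ) where

  open CommutativeRing K
  open IntegerCoefficients K
  open Summation K
  open Sum semiring using (sum; sum-cong-≋; *-distribˡ-sum)
  open Exp commutativeSemiring using (_^_)
  open Mult semiring using (×1-homo-*; ×-assoc-*; ×-congʳ; ×-congˡ) renaming (_×_ to _·_)
  open SetoidReasoning setoid

  term : Carrier → ℕ → Carrier
  term z k = κ k * z ^ k

  partialSum : Carrier → ℕ → Carrier
  partialSum z = Σ< (term z)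

  nCk*k!*[n∸k]!≡n! : ∀ {n k} → k ℕ.≤ n → (n C k) ℕ.* (k ! ℕ.* (n ∸ k) !) ≡ n !
  nCk*k!*[n∸k]!≡n! {n} {k} k≤n = ≡.trans
    (≡.cong (ℕ._* (k ! ℕ.* (n ∸ k) !)) (nCk≡n!/k![n-k]! k≤n))
    (m/n*n≡m (k![n∸k]!∣n! k≤n))
    where instance _ = k ℕ.!* n ∸ k !≢0

  -- All that is known of `κ` is that `n! κ n ≈ 1`. So the factors `k! κ k` and
  -- `(n - k)! κ (n - k)`, both equal to one, are inserted, and `(n C k) k! (n - k)! = n!` then
  -- cancels against `κ n`.
  κ-binomial : ∀ {n k} → k ℕ.≤ n → κ n * ((n C k) · 1#) ≈ κ k * κ (n ∸ k)
  κ-binomial {n} {k} k≤n = begin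
    κ n * B
      ≈⟨ solve 2 (λ x B → x :* B := con (+ 1) :* con (+ 1) :* (x :* B)) refl (κ n) B ⟩
    (1 · 1#) * (1 · 1#) * (κ n * B)
      ≈⟨ *-congʳ (*-cong (trans (+-identityʳ 1#) (sym (n!κₙ≈1 k)))
                         (trans (+-identityʳ 1#) (sym (n!κₙ≈1 (n ∸ k))))) ⟩
    (k! * κ k) * (j! * κ (n ∸ k)) * (κ n * B)
      ≈⟨ solve 6 (λ a b p q x B → (a :* p) :* (b :* q) :* (x :* B) := p :* q :* (B :* (a :* b) :* x))
           refl k! j! (κ k) (κ (n ∸ k)) (κ n) B ⟩
    κ k * κ (n ∸ k) * (B * (k! * j!) * κ n)
      ≈⟨ *-congˡ (*-congʳ (trans (*-congˡ (sym (×1-homo-* (k !) ((n ∸ k) !)))) (sym (×1-homo-* (n C k) _)))) ⟩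
    κ k * κ (n ∸ k) * (((n C k) ℕ.* (k ! ℕ.* (n ∸ k) !)) · 1# * κ n)
      ≈⟨ *-congˡ (*-congʳ (×-congˡ (nCk*k!*[n∸k]!≡n! k≤n))) ⟩
    κ k * κ (n ∸ k) * ((n !) · 1# * κ n)
      ≈⟨ *-congˡ (n!κₙ≈1 n) ⟩
    κ k * κ (n ∸ k) * 1#
      ≈⟨ *-identityʳ _ ⟩
    κ k * κ (n ∸ k) ∎
    where
    B  = (n C k) · 1#
    k! = (k !) · 1#
    j! = ((n ∸ k) !) · 1#

  -- The binomial theorem divided by `n!`: the part of degree `n` of the Cauchy product.
  term-+ : ∀ z w n → term (z + w) n ≈ Σ< (λ i → term z i * term w (n ∸ i)) (suc n)
  term-+ z w n = begin
    κ n * (z + w) ^ n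
      ≈⟨ *-congˡ (Binomial.theorem commutativeSemiring n z w) ⟩
    κ n * sum {suc n} (λ i → (n C toℕ i) · (z ^ toℕ i * w ^ (n ∸ toℕ i)))
      ≈⟨ *-distribˡ-sum {suc n} (κ n) (λ i → (n C toℕ i) · (z ^ toℕ i * w ^ (n ∸ toℕ i))) ⟩
    sum {suc n} (λ i → κ n * ((n C toℕ i) · (z ^ toℕ i * w ^ (n ∸ toℕ i))))
      ≈⟨ sum-cong-≋ {suc n} (λ i → summand (toℕ i) (ℕ.≤-pred (toℕ<n i))) ⟩
    sum {suc n} (λ i → term z (toℕ i) * term w (n ∸ toℕ i))
      ≈⟨ sum≈Σ< (λ i → term z i * term w (n ∸ i)) (suc n) ⟩
    Σ< (λ i → term z i * term w (n ∸ i)) (suc n) ∎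
    where
    summand : ∀ i → i ℕ.≤ n → κ n * ((n C i) · (z ^ i * w ^ (n ∸ i))) ≈ term z i * term w (n ∸ i)
    summand i i≤n = begin
      κ n * ((n C i) · (z ^ i * w ^ (n ∸ i)))
        ≈⟨ *-congˡ (×-congʳ (n C i) (*-identityˡ _)) ⟨
      κ n * ((n C i) · (1# * (z ^ i * w ^ (n ∸ i))))
        ≈⟨ *-congˡ (×-assoc-* (n C i) 1# _) ⟨
      κ n * ((n C i) · 1# * (z ^ i * w ^ (n ∸ i)))
        ≈⟨ *-assoc _ _ _ ⟨
      κ n * ((n C i) · 1#) * (z ^ i * w ^ (n ∸ i))
        ≈⟨ *-congʳ (κ-binomial i≤n) ⟩
      κ i * κ (n ∸ i) * (z ^ i * w ^ (n ∸ i))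
        ≈⟨ solve 4 (λ p q x y → p :* q :* (x :* y) := p :* x :* (q :* y))
             refl (κ i) (κ (n ∸ i)) (z ^ i) (w ^ (n ∸ i)) ⟩
      term z i * term w (n ∸ i) ∎

  -- By `term-+`, the left side sums `term z i * term w j` over the triangle `i + j < n`; the right
  -- side sums the same triangle row by row. The induction step adds the diagonal `i + j = n`, which
  -- lengthens each row by one entry.
  partialSum-+ : ∀ z w n → partialSum (z + w) n ≈ Σ< (λ i → term z i * partialSum w (n ∸ i)) n
  partialSum-+ z w zero    = refl
  partialSum-+ z w (suc n) = begin
    partialSum (z + w) n + term (z + w) n
      ≈⟨ +-cong (partialSum-+ z w n) (term-+ z w n) ⟩
    Σ< f n + Σ< g (suc n)
      -- The row `i = n` is opened with the empty sum, so that both sums have `suc n` rows.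
      ≈⟨ +-congʳ (+-identityʳ _) ⟨
    Σ< f n + 0# + Σ< g (suc n)
      ≈⟨ +-congʳ (+-congˡ (trans (*-congˡ (reflexive (≡.cong (partialSum w) (ℕ.n∸n≡0 n)))) (zeroʳ _))) ⟨
    Σ< f (suc n) + Σ< g (suc n)
      ≈⟨ Σ<-+ f g (suc n) ⟨
    Σ< (λ i → f i + g i) (suc n)
      ≈⟨ Σ<-cong (suc n) (λ i i<1+n → trans (sym (distribˡ _ _ _))
           (*-congˡ (reflexive (≡.cong (partialSum w) (≡.sym (ℕ.+-∸-assoc 1 (ℕ.≤-pred i<1+n))))))) ⟩
    Σ< (λ i → term z i * partialSum w (suc n ∸ i)) (suc n) ∎
    where
    f g : ℕ → Carrier
    f i = term z i * partialSum w (n ∸ i)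
    g i = term z i * term w (n ∸ i)

  -- The product of partial sums covers the square `i, j < n`, the partial sum at `z + w` only the
  -- triangle `i + j < n`. The right side is the rest of the square, row by row.
  partialSum-*-defect : ∀ z w n → partialSum z n * partialSum w n - partialSum (z + w) n ≈
                        Σ< (λ i → term z i * (partialSum w n - partialSum w (n ∸ i))) n
  partialSum-*-defect z w n = begin
    partialSum z n * partialSum w n - partialSum (z + w) n
      ≈⟨ +-cong (Σ<-*ʳ (term z) _ n) (-‿cong (sym (partialSum-+ z w n))) ⟨
    Σ< (λ i → term z i * partialSum w n) n - Σ< (λ i → term z i * partialSum w (n ∸ i)) n
      ≈⟨ Σ<-- _ _ n ⟨
    Σ< (λ i → term z i * partialSum w n - term z i * partialSum w (n ∸ i)) n
      ≈⟨ Σ<-cong n (λ i _ → solve 3 (λ e S T → e :* S :- e :* T := e :* (S :- T)) refl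
           (term z i) (partialSum w n) (partialSum w (n ∸ i))) ⟩
    Σ< (λ i → term z i * (partialSum w n - partialSum w (n ∸ i))) n ∎

-- The complex exponential: existence, addition theorem, linear approximation.

module ComplexExponential {c ℓ₁ ℓ₂} (R : CompleteOrderedField c ℓ₁ ℓ₂) where
  open CompleteOrderedField R renaming (Carrier to ℝ)
  open Analysis R
  open IntegerCoefficients commutativeRing
  open OrderedField R
  open Limits R
  open Summation commutativeRing using (Σ<; Σ<-*ʳ)
  open Exp commutativeSemiring using (_^_)
  open Mult semiring using (×1-homo-*)
  open Exp ℂ-ring.commutativeSemiring using () renaming (_^_ to _^ᶜ_; ^-congˡ to ^ᶜ-congˡ)
  module Σᶜ = Summation ℂ-commutativeRing
  open RingProperties ring using (-0#≈0#)
  open <-Reasoning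

  κ : ℕ → ℝ
  κ n = 1# / fromℕ (n !)

  n!-pos : ∀ n → 0# < fromℕ (n !)
  n!-pos n = fromℕ-pos (n !) where instance _ = n ℕ.!≢0

  n!κₙ≈1 : InverseFactorials commutativeRing κ
  n!κₙ≈1 n = trans (*-congˡ (*-identityˡ _)) (pos⇒x*x⁻¹≈1 (n!-pos n))

  κ-nonneg : ∀ n → 0# ≤ κ n
  κ-nonneg n = *-nonneg (<⇒≤ 0<1) (<⇒≤ (⁻¹-pos (n!-pos n)))

  κ-suc : ∀ n → fromℕ (suc n) * κ (suc n) ≈ κ n
  κ-suc n = begin-equality
    fromℕ (suc n) * κ (suc n)
      ≈⟨ *-identityʳ _ ⟨
    fromℕ (suc n) * κ (suc n) * 1#
      ≈⟨ *-congˡ (n!κₙ≈1 n) ⟨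
    fromℕ (suc n) * κ (suc n) * (fromℕ (n !) * κ n)
      ≈⟨ solve 4 (λ N k′ f k → N :* k′ :* (f :* k) := N :* f :* k′ :* k) refl
           (fromℕ (suc n)) (κ (suc n)) (fromℕ (n !)) (κ n) ⟩
    fromℕ (suc n) * fromℕ (n !) * κ (suc n) * κ n
      ≈⟨ *-congʳ (*-congʳ (×1-homo-* (suc n) (n !))) ⟨
    fromℕ (suc n !) * κ (suc n) * κ n
      ≈⟨ *-congʳ (n!κₙ≈1 (suc n)) ⟩
    1# * κ n
      ≈⟨ *-identityˡ _ ⟩
    κ n ∎

  ofReal-* : ∀ x y → ofReal (x * y) ≈ᶜ ofReal x *ᶜ ofReal y
  ofReal-* x y =
    solve 2 (λ x y → x :* y := x :* y :- con (+ 0) :* con (+ 0)) refl x y ,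
    solve 2 (λ x y → con (+ 0) := x :* con (+ 0) :+ con (+ 0) :* y) refl x y

  fromℕᶜ : ∀ n → Mult._×_ ℂ-ring.semiring n 1ᶜ ≈ᶜ ofReal (fromℕ n)
  fromℕᶜ zero    = refl , refl
  fromℕᶜ (suc n) = +-congˡ (proj₁ (fromℕᶜ n)) , trans (+-congˡ (proj₂ (fromℕᶜ n))) (+-identityʳ 0#)

  n!κₙ≈1ᶜ : InverseFactorials ℂ-commutativeRing (ofReal ∘ κ)
  n!κₙ≈1ᶜ n = ℂ-ring.trans (ℂ-ring.*-congʳ (fromℕᶜ (n !)))
    (ℂ-ring.trans (ℂ-ring.sym (ofReal-* _ _)) (n!κₙ≈1 n , refl))

  open ExponentialSeries commutativeRing κ n!κₙ≈1
  module Expᶜ = ExponentialSeries ℂ-commutativeRing (ofReal ∘ κ) n!κₙ≈1ᶜ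

  -- The ℓ¹ norm is submultiplicative and needs no square roots.
  ‖_‖ : ℂ → ℝ
  ‖ z ‖ = ∣ re z ∣ + ∣ im z ∣

  ‖‖-nonneg : ∀ z → 0# ≤ ‖ z ‖
  ‖‖-nonneg z = +-nonneg (∣∣-nonneg _) (∣∣-nonneg _)

  ∣re∣≤‖‖ : ∀ z → ∣ re z ∣ ≤ ‖ z ‖
  ∣re∣≤‖‖ z = ≤-respˡ (+-identityʳ _) (+-mono-≤ ≤-refl (∣∣-nonneg _))

  ∣im∣≤‖‖ : ∀ z → ∣ im z ∣ ≤ ‖ z ‖
  ∣im∣≤‖‖ z = ≤-respˡ (+-identityˡ _) (+-mono-≤ (∣∣-nonneg _) ≤-refl)

  ‖‖-cong : ∀ {z w} → z ≈ᶜ w → ‖ z ‖ ≤ ‖ w ‖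
  ‖‖-cong (p , q) = +-mono-≤ (∣∣-cong p) (∣∣-cong q)

  ‖z+w‖≤ : ∀ z w → ‖ z +ᶜ w ‖ ≤ ‖ z ‖ + ‖ w ‖
  ‖z+w‖≤ (a +i b) (x +i y) = begin
    ∣ a + x ∣ + ∣ b + y ∣
      ≤⟨ +-mono-≤ (∣x+y∣≤∣x∣+∣y∣ a x) (∣x+y∣≤∣x∣+∣y∣ b y) ⟩
    (∣ a ∣ + ∣ x ∣) + (∣ b ∣ + ∣ y ∣)
      ≈⟨ solve 4 (λ a b x y → (a :+ x) :+ (b :+ y) := (a :+ b) :+ (x :+ y)) refl (∣ a ∣) (∣ b ∣) (∣ x ∣) (∣ y ∣) ⟩
    (∣ a ∣ + ∣ b ∣) + (∣ x ∣ + ∣ y ∣) ∎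

  ‖z*w‖≤ : ∀ z w → ‖ z *ᶜ w ‖ ≤ ‖ z ‖ * ‖ w ‖
  ‖z*w‖≤ (a +i b) (x +i y) = begin
    ∣ a * x - b * y ∣ + ∣ a * y + b * x ∣
      ≤⟨ +-mono-≤ (∣x+y∣≤∣x∣+∣y∣ _ _) (∣x+y∣≤∣x∣+∣y∣ _ _) ⟩
    (∣ a * x ∣ + ∣ - (b * y) ∣) + (∣ a * y ∣ + ∣ b * x ∣)
      ≤⟨ +-mono-≤ (+-mono-≤ (∣x*y∣≤∣x∣*∣y∣ a x) (≤-trans (∣-x∣≤∣x∣ _) (∣x*y∣≤∣x∣*∣y∣ b y)))
                  (+-mono-≤ (∣x*y∣≤∣x∣*∣y∣ a y) (∣x*y∣≤∣x∣*∣y∣ b x)) ⟩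
    (∣ a ∣ * ∣ x ∣ + ∣ b ∣ * ∣ y ∣) + (∣ a ∣ * ∣ y ∣ + ∣ b ∣ * ∣ x ∣)
      ≈⟨ solve 4 (λ a b x y → (a :* x :+ b :* y) :+ (a :* y :+ b :* x) := (a :+ b) :* (x :+ y)) refl
           (∣ a ∣) (∣ b ∣) (∣ x ∣) (∣ y ∣) ⟩
    (∣ a ∣ + ∣ b ∣) * (∣ x ∣ + ∣ y ∣) ∎

  ‖ofReal‖≤ : ∀ {x} → 0# ≤ x → ‖ ofReal x ‖ ≤ x
  ‖ofReal‖≤ {x} 0≤x = ≤-respʳ (+-identityʳ x) (+-mono-≤ (nonneg⇒∣x∣≤x 0≤x) (nonneg⇒∣x∣≤x ≤-refl))

  ^-nonneg : ∀ {x} → 0# ≤ x → ∀ n → 0# ≤ x ^ n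
  ^-nonneg 0≤x zero    = <⇒≤ 0<1
  ^-nonneg 0≤x (suc n) = *-nonneg 0≤x (^-nonneg 0≤x n)

  ‖z^n‖≤ : ∀ z n → ‖ z ^ᶜ n ‖ ≤ ‖ z ‖ ^ n
  ‖z^n‖≤ z zero    = ‖ofReal‖≤ (<⇒≤ 0<1)
  ‖z^n‖≤ z (suc n) = ≤-trans (‖z*w‖≤ z (z ^ᶜ n)) (*-monoˡ-≤ (‖‖-nonneg z) (‖z^n‖≤ z n))

  term-nonneg : ∀ {x} → 0# ≤ x → ∀ n → 0# ≤ term x n
  term-nonneg 0≤x n = *-nonneg (κ-nonneg n) (^-nonneg 0≤x n)

  ‖term‖≤ : ∀ z n → ‖ Expᶜ.term z n ‖ ≤ term (‖ z ‖) n
  ‖term‖≤ z n = ≤-trans (‖z*w‖≤ _ _)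
    (*-mono-≤ (‖‖-nonneg _) (^-nonneg (‖‖-nonneg z) n) (‖ofReal‖≤ (κ-nonneg n)) (‖z^n‖≤ z n))

  Σ<-mono : ∀ {f g} n → (∀ i → i ℕ.< n → f i ≤ g i) → Σ< f n ≤ Σ< g n
  Σ<-mono zero    f≤g = ≤-refl
  Σ<-mono (suc n) f≤g = +-mono-≤ (Σ<-mono n λ i i<n → f≤g i (ℕ.m<n⇒m<1+n i<n)) (f≤g n (ℕ.n<1+n n))

  ‖Σ<‖≤ : ∀ f n → ‖ Σᶜ.Σ< f n ‖ ≤ Σ< (‖_‖ ∘ f) n
  ‖Σ<‖≤ f zero    = ‖ofReal‖≤ ≤-refl
  ‖Σ<‖≤ f (suc n) = ≤-trans (‖z+w‖≤ (Σᶜ.Σ< f n) (f n)) (+-mono-≤ (‖Σ<‖≤ f n) ≤-refl)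

  partialSum-mono : ∀ {x} → 0# ≤ x → ∀ {m n} → m ℕ.≤ n → partialSum x m ≤ partialSum x n
  partialSum-mono 0≤x = steps⇒monotone λ n → ≤-respˡ (+-identityʳ _) (+-mono-≤ ≤-refl (term-nonneg 0≤x n))

  -- The real series at `‖ z ‖` dominates the complex series term by term. Convergence, the addition
  -- theorem and the linear approximation all reduce to real series through this bound.
  ‖partialSum-diff‖≤ : ∀ z {m n} → m ℕ.≤ n →
    ‖ Expᶜ.partialSum z n ℂ-ring.- Expᶜ.partialSum z m ‖ ≤ partialSum (‖ z ‖) n - partialSum (‖ z ‖) m
  ‖partialSum-diff‖≤ z m≤n = go (ℕ.≤⇒≤′ m≤n)
    where
    S : ℕ → ℂ
    S = Expᶜ.partialSum z
    A : ℕ → ℝ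
    A = partialSum (‖ z ‖)
    go : ∀ {m n} → m ℕ.≤′ n → ‖ S n ℂ-ring.- S m ‖ ≤ A n - A m
    go {m} ℕ.≤′-refl = begin
      ‖ S m ℂ-ring.- S m ‖  ≤⟨ ‖‖-cong (ℂ-ring.-‿inverseʳ (S m)) ⟩
      ‖ 0ᶜ ‖                ≤⟨ ‖ofReal‖≤ ≤-refl ⟩
      0#                    ≈⟨ -‿inverseʳ (A m) ⟨
      A m - A m             ∎
    go {m} {suc n} (ℕ.≤′-step m≤n) = begin
      ‖ S (suc n) ℂ-ring.- S m ‖
        ≤⟨ ‖‖-cong (solve 3 (λ x t y → x :+ t :- y := x :- y :+ t) refl _ _ _
                   , solve 3 (λ x t y → x :+ t :- y := x :- y :+ t) refl _ _ _) ⟩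
      ‖ (S n ℂ-ring.- S m) +ᶜ Expᶜ.term z n ‖
        ≤⟨ ‖z+w‖≤ (S n ℂ-ring.- S m) (Expᶜ.term z n) ⟩
      ‖ S n ℂ-ring.- S m ‖ + ‖ Expᶜ.term z n ‖
        ≤⟨ +-mono-≤ (go m≤n) (‖term‖≤ z n) ⟩
      A n - A m + term (‖ z ‖) n
        ≈⟨ solve 3 (λ x t y → x :+ t :- y := x :- y :+ t) refl (A n) (term (‖ z ‖) n) (A m) ⟨
      A (suc n) - A m ∎

  fromℕ-mono : ∀ {m n} → m ℕ.≤ n → fromℕ m ≤ fromℕ n
  fromℕ-mono = steps⇒monotone λ n → ≤-respˡ (+-identityˡ _) (+-mono-≤ (<⇒≤ 0<1) ≤-refl)

  -- The quotient of consecutive terms is `x / (n + 1)`, which the hypothesis makes at most one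
  -- half.
  term-halves : ∀ {x} → 0# ≤ x → ∀ n → x + x ≤ fromℕ (suc n) → term x (suc n) + term x (suc n) ≤ term x n
  term-halves {x} 0≤x n 2x≤1+n = begin
    term x (suc n) + term x (suc n)
      ≈⟨ solve 3 (λ k x p → k :* (x :* p) :+ k :* (x :* p) := k :* p :* (x :+ x)) refl (κ (suc n)) x (x ^ n) ⟩
    κ (suc n) * x ^ n * (x + x)
      ≤⟨ *-monoˡ-≤ (*-nonneg (κ-nonneg (suc n)) (^-nonneg 0≤x n)) 2x≤1+n ⟩
    κ (suc n) * x ^ n * fromℕ (suc n)
      ≈⟨ solve 3 (λ k p N → k :* p :* N := N :* k :* p) refl (κ (suc n)) (x ^ n) (fromℕ (suc n)) ⟩
    fromℕ (suc n) * κ (suc n) * x ^ n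
      ≈⟨ *-congʳ (κ-suc n) ⟩
    term x n ∎

  -- partialSum x n + 2 term x n decreases for n ≥ m, because the terms at least halve.
  partialSum-tail : ∀ {x} → 0# ≤ x → ∀ {m} → x + x ≤ fromℕ (suc m) → ∀ {n} → m ℕ.≤ n →
                    partialSum x n ≤ partialSum x m + (term x m + term x m)
  partialSum-tail {x} 0≤x {m} 2x≤1+m {n} m≤n =
    ≤-trans (≤-respˡ (+-identityʳ (partialSum x n)) (+-mono-≤ ≤-refl (+-nonneg (term-nonneg 0≤x n) (term-nonneg 0≤x n))))
            (go (ℕ.≤⇒≤′ m≤n))
    where
    go : ∀ {n} → m ℕ.≤′ n → partialSum x n + (term x n + term x n) ≤ partialSum x m + (term x m + term x m)
    go ℕ.≤′-refl = ≤-refl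
    go {suc n} (ℕ.≤′-step m≤n) = begin
      partialSum x n + term x n + (term x (suc n) + term x (suc n))
        ≤⟨ +-mono-≤ ≤-refl (term-halves 0≤x n
             (≤-trans 2x≤1+m (fromℕ-mono (ℕ.s≤s (ℕ.≤′⇒≤ m≤n))))) ⟩
      partialSum x n + term x n + term x n
        ≈⟨ +-assoc _ _ _ ⟩
      partialSum x n + (term x n + term x n)
        ≤⟨ go m≤n ⟩
      partialSum x m + (term x m + term x m) ∎

  partialSum-bounded : ∀ {x} → 0# ≤ x → ∃[ b ] ∀ n → partialSum x n ≤ b
  partialSum-bounded {x} 0≤x with archimedean (x + x)
  ... | m , 2x<m = partialSum x m + (term x m + term x m) , λ n →
    ≤-trans (partialSum-mono 0≤x (ℕ.m≤m⊔n n m))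
            (partialSum-tail 0≤x (≤-trans (<⇒≤ 2x<m) (fromℕ-mono (ℕ.n≤1+n m))) (ℕ.m≤n⊔m n m))

  partialSum-converges : ∀ {x} → 0# ≤ x → ∃[ l ] partialSum x ⟶ l
  partialSum-converges 0≤x =
    monotone-convergence (λ n → partialSum-mono 0≤x (ℕ.n≤1+n n)) (proj₂ (partialSum-bounded 0≤x))

  infix 4 _⟶ᶜ_
  _⟶ᶜ_ : (ℕ → ℂ) → ℂ → Set _
  s ⟶ᶜ z = ((re ∘ s) ⟶ re z) × ((im ∘ s) ⟶ im z)

  ⟶ᶜ-cong : ∀ {s t z w} → (∀ n → s n ≈ᶜ t n) → z ≈ᶜ w → s ⟶ᶜ z → t ⟶ᶜ w
  ⟶ᶜ-cong s≈t (p , q) (r , i) = ⟶-cong (proj₁ ∘ s≈t) p r , ⟶-cong (proj₂ ∘ s≈t) q i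

  expSum≈partialSum : ∀ z n → expSum z n ≈ᶜ Expᶜ.partialSum z n
  expSum≈partialSum z = Σᶜ.sum≈Σ< (Expᶜ.term z)

  IsExp⇒⟶ : ∀ {z e} → IsExp z e → Expᶜ.partialSum z ⟶ᶜ e
  IsExp⇒⟶ {z} = ⟶ᶜ-cong (expSum≈partialSum z) ℂ-ring.refl

  ⟶⇒IsExp : ∀ {z e} → Expᶜ.partialSum z ⟶ᶜ e → IsExp z e
  ⟶⇒IsExp {z} = ⟶ᶜ-cong (λ n → ℂ-ring.sym (expSum≈partialSum z n)) ℂ-ring.refl

  partialSum-cong : ∀ {z w} → z ≈ᶜ w → ∀ n → Expᶜ.partialSum z n ≈ᶜ Expᶜ.partialSum w n
  partialSum-cong z≈w n = Σᶜ.Σ<-cong n λ k _ → ℂ-ring.*-congˡ (^ᶜ-congˡ k z≈w)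

  IsExp-cong : ∀ {z w e} → z ≈ᶜ w → IsExp z e → IsExp w e
  IsExp-cong z≈w exp = ⟶⇒IsExp (⟶ᶜ-cong (partialSum-cong z≈w) ℂ-ring.refl (IsExp⇒⟶ exp))

  exp-unique : ∀ {z e e′} → IsExp z e → IsExp z e′ → e ≈ᶜ e′
  exp-unique (p , q) (p′ , q′) = ⟶-unique p p′ , ⟶-unique q q′

  exp-exists : ∀ z → ∃[ e ] IsExp z e
  exp-exists z =
    let _ , bound = partialSum-bounded (‖‖-nonneg z)
        r , ⟶r = dominated-convergence {u = re ∘ Expᶜ.partialSum z} (λ n →
                    ≤-trans (∣re∣≤‖‖ (Expᶜ.partialSum z (suc n) ℂ-ring.- Expᶜ.partialSum z n))
                            (‖partialSum-diff‖≤ z (ℕ.n≤1+n n))) bound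
        i , ⟶i = dominated-convergence {u = im ∘ Expᶜ.partialSum z} (λ n →
                    ≤-trans (∣im∣≤‖‖ (Expᶜ.partialSum z (suc n) ℂ-ring.- Expᶜ.partialSum z n))
                            (‖partialSum-diff‖≤ z (ℕ.n≤1+n n))) bound
    in (r +i i) , ⟶⇒IsExp (⟶r , ⟶i)

  -- All terms are nonnegative, and the square `i, j < n` lies inside the triangle `i + j < 2n`:
  -- first the rows are lengthened, then further rows are added.
  partialSum-*≤ : ∀ {x y} → 0# ≤ x → 0# ≤ y → ∀ n → partialSum x n * partialSum y n ≤ partialSum (x + y) (n ℕ.+ n)
  partialSum-*≤ {x} {y} 0≤x 0≤y n = begin
    partialSum x n * partialSum y n
      ≈⟨ Σ<-*ʳ (term x) (partialSum y n) n ⟨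
    Σ< (λ i → term x i * partialSum y n) n
      ≤⟨ Σ<-mono n (λ i i<n → *-monoˡ-≤ (term-nonneg 0≤x i) (partialSum-mono 0≤y
           (ℕ.m+n≤o⇒m≤o∸n n (ℕ.+-monoʳ-≤ n (ℕ.<⇒≤ i<n))))) ⟩
    Σ< (λ i → term x i * partialSum y (n ℕ.+ n ∸ i)) n
      ≤⟨ steps⇒monotone {Σ< (λ i → term x i * partialSum y (n ℕ.+ n ∸ i))}
           (λ i → ≤-respˡ (+-identityʳ _) (+-mono-≤ ≤-refl (*-nonneg (term-nonneg 0≤x i)
             (partialSum-mono 0≤y (ℕ.z≤n {n ℕ.+ n ∸ i}))))) (ℕ.m≤m+n n n) ⟩
    Σ< (λ i → term x i * partialSum y (n ℕ.+ n ∸ i)) (n ℕ.+ n)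
      ≈⟨ partialSum-+ x y (n ℕ.+ n) ⟨
    partialSum (x + y) (n ℕ.+ n) ∎

  -- Taking norms in `partialSum-*-defect` term by term produces the same expression for the real
  -- series at `‖ z ‖` and `‖ w ‖`. Read backwards it is a real defect, which `partialSum-*≤` turns
  -- into a difference of two partial sums of one convergent series.
  ‖*-defect‖≤ : ∀ z w n →
    ‖ Expᶜ.partialSum z n *ᶜ Expᶜ.partialSum w n ℂ-ring.- Expᶜ.partialSum (z +ᶜ w) n ‖ ≤
    partialSum (‖ z ‖ + ‖ w ‖) (n ℕ.+ n) - partialSum (‖ z ‖ + ‖ w ‖) n
  ‖*-defect‖≤ z w n = begin
    ‖ Expᶜ.partialSum z n *ᶜ Expᶜ.partialSum w n ℂ-ring.- Expᶜ.partialSum (z +ᶜ w) n ‖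
      ≤⟨ ‖‖-cong (Expᶜ.partialSum-*-defect z w n) ⟩
    ‖ Σᶜ.Σ< (λ i → Expᶜ.term z i *ᶜ (Expᶜ.partialSum w n ℂ-ring.- Expᶜ.partialSum w (n ∸ i))) n ‖
      ≤⟨ ‖Σ<‖≤ _ n ⟩
    Σ< (λ i → ‖ Expᶜ.term z i *ᶜ (Expᶜ.partialSum w n ℂ-ring.- Expᶜ.partialSum w (n ∸ i)) ‖) n
      ≤⟨ Σ<-mono n (λ i _ → ≤-trans (‖z*w‖≤ (Expᶜ.term z i) _)
           (*-mono-≤ (‖‖-nonneg (Expᶜ.term z i))
                     (x≤y⇒0≤y-x (partialSum-mono (‖‖-nonneg w) (ℕ.m∸n≤m n i)))
                     (‖term‖≤ z i) (‖partialSum-diff‖≤ w (ℕ.m∸n≤m n i)))) ⟩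
    Σ< (λ i → term (‖ z ‖) i * (partialSum (‖ w ‖) n - partialSum (‖ w ‖) (n ∸ i))) n
      ≈⟨ partialSum-*-defect (‖ z ‖) (‖ w ‖) n ⟨
    partialSum (‖ z ‖) n * partialSum (‖ w ‖) n - partialSum (‖ z ‖ + ‖ w ‖) n
      ≤⟨ +-mono-≤ (partialSum-*≤ (‖‖-nonneg z) (‖‖-nonneg w) n) ≤-refl ⟩
    partialSum (‖ z ‖ + ‖ w ‖) (n ℕ.+ n) - partialSum (‖ z ‖ + ‖ w ‖) n ∎

  -- Products of partial sums tend to `e *ᶜ e′`. They differ from the partial sums at `z +ᶜ w` by
  -- `D`, which is squeezed to zero because the real partial sums `A (n + n)` and `A n` have the
  -- same limit.
  exp-+ : ∀ {z w e e′} → IsExp z e → IsExp w e′ → IsExp (z +ᶜ w) (e *ᶜ e′)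
  exp-+ {z} {w} {e} {e′} exp-z exp-w = ⟶⇒IsExp
    ( corrected (∣re∣≤‖‖ ∘ D) (⟶-+ (⟶-* r r′) (⟶-neg (⟶-* i i′)))
    , corrected (∣im∣≤‖‖ ∘ D) (⟶-+ (⟶-* r i′) (⟶-* i r′)) )
    where
    r  = proj₁ (IsExp⇒⟶ exp-z)
    i  = proj₂ (IsExp⇒⟶ exp-z)
    r′ = proj₁ (IsExp⇒⟶ exp-w)
    i′ = proj₂ (IsExp⇒⟶ exp-w)

    D : ℕ → ℂ
    D n = Expᶜ.partialSum z n *ᶜ Expᶜ.partialSum w n ℂ-ring.- Expᶜ.partialSum (z +ᶜ w) n

    A : ℕ → ℝ
    A = partialSum (‖ z ‖ + ‖ w ‖)

    gap⟶0 : (λ n → A (n ℕ.+ n) - A n) ⟶ 0#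
    gap⟶0 =
      let l , A⟶l = partialSum-converges (+-nonneg (‖‖-nonneg z) (‖‖-nonneg w))
      in ⟶-cong (λ _ → refl) (-‿inverseʳ l)
           (⟶-+ (⟶-subsequence {φ = λ n → n ℕ.+ n} (λ n → ℕ.m≤m+n n n) A⟶l) (⟶-neg A⟶l))

    corrected : ∀ {u v l} → (∀ n → ∣ u n - v n ∣ ≤ ‖ D n ‖) → u ⟶ l → v ⟶ l
    corrected {u} {v} {l} bound u⟶l = ⟶-cong
      (λ n → solve 2 (λ u v → u :- (u :- v) := v) refl (u n) (v n))
      (solve 1 (λ l → l :- con (+ 0) := l) refl l)
      (⟶-+ u⟶l (⟶-neg (⟶-squeeze {u = λ n → u n - v n} {l = 0#} (λ n → ≤-trans
        (∣∣-cong (solve 1 (λ d → d :- con (+ 0) := d) refl (u n - v n)))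
        (≤-trans (bound n) (‖*-defect‖≤ z w n))) gap⟶0)))

  conj : ℂ → ℂ
  conj (x +i y) = x +i (- y)

  conj-* : ∀ z w → conj (z *ᶜ w) ≈ᶜ conj z *ᶜ conj w
  conj-* (a +i b) (x +i y) =
    solve 4 (λ a b x y → a :* x :- b :* y := a :* x :- :- b :* :- y) refl a b x y ,
    solve 4 (λ a b x y → :- (a :* y :+ b :* x) := a :* :- y :+ :- b :* x) refl a b x y

  conj-^ : ∀ z n → conj (z ^ᶜ n) ≈ᶜ conj z ^ᶜ n
  conj-^ z zero    = refl , -0#≈0#
  conj-^ z (suc n) = ℂ-ring.trans (conj-* z (z ^ᶜ n)) (ℂ-ring.*-congˡ (conj-^ z n))

  conj-partialSum : ∀ z n → conj (Expᶜ.partialSum z n) ≈ᶜ Expᶜ.partialSum (conj z) n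
  conj-partialSum z zero    = refl , -0#≈0#
  conj-partialSum z (suc n) = ℂ-ring.trans
    (refl , solve 2 (λ x y → :- (x :+ y) := :- x :+ :- y) refl _ _)
    (ℂ-ring.+-cong (conj-partialSum z n) (ℂ-ring.trans (conj-* (ofReal (κ n)) (z ^ᶜ n))
      (ℂ-ring.*-cong {conj (ofReal (κ n))} {ofReal (κ n)} (refl , -0#≈0#) (conj-^ z n))))

  -- The coefficients of the series are real, so conjugation passes through each partial sum. On the
  -- imaginary axis this makes cosine even and sine odd.
  exp-conj : ∀ {z e} → IsExp z e → IsExp (conj z) (conj e)
  exp-conj {z} {e} exp-z = ⟶⇒IsExp (⟶ᶜ-cong (conj-partialSum z) ℂ-ring.refl
    (proj₁ (IsExp⇒⟶ exp-z) , ⟶-neg (proj₂ (IsExp⇒⟶ exp-z))))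

  partialSum-2 : ∀ z → Expᶜ.partialSum z 2 ≈ᶜ 1ᶜ +ᶜ z
  partialSum-2 z = ℂ-ring.+-cong
    (ℂ-ring.trans (ℂ-ring.+-identityˡ _) (ℂ-ring.trans (ℂ-ring.*-identityʳ _) (κ₁≈1 , refl)))
    (ℂ-ring.trans (ℂ-ring.*-cong {ofReal (κ 1)} (κ₁≈1 , refl) (ℂ-ring.*-identityʳ z)) (ℂ-ring.*-identityˡ z))
    where
    κ₁≈1 : κ 1 ≈ 1#
    κ₁≈1 = trans (solve 1 (λ k → k := con (+ 1) :* k) refl (κ 1)) (n!κₙ≈1 1)

  -- From index 2 on the terms at `‖ z ‖` at least halve, so the tail is at most twice the quadratic
  -- term, and `2 κ 2 ≈ 1` makes this `‖ z ‖²`. The bound `x` replaces the norm so that callers can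
  -- insert `∣ h ∣` or a positive `h`.
  exp-linear-approximation : ∀ {z e x} → ‖ z ‖ ≤ x → x + x ≤ 1# → IsExp z e →
    ∣ re e - re (1ᶜ +ᶜ z) ∣ ≤ x * x × ∣ im e - im (1ᶜ +ᶜ z) ∣ ≤ x * x
  exp-linear-approximation {z} {e} {x} ‖z‖≤x 2x≤1 exp-z =
    ⟶-∣-∣≤ 2 (proj₁ (IsExp⇒⟶ exp-z)) (λ n 2≤n → ≤-trans
      (≤-trans (∣∣-cong (+-congˡ (-‿cong (sym (proj₁ (partialSum-2 z))))))
        (∣re∣≤‖‖ (Expᶜ.partialSum z n ℂ-ring.- Expᶜ.partialSum z 2))) (bound n 2≤n)) ,
    ⟶-∣-∣≤ 2 (proj₂ (IsExp⇒⟶ exp-z)) (λ n 2≤n → ≤-trans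
      (≤-trans (∣∣-cong (+-congˡ (-‿cong (sym (proj₂ (partialSum-2 z))))))
        (∣im∣≤‖‖ (Expᶜ.partialSum z n ℂ-ring.- Expᶜ.partialSum z 2))) (bound n 2≤n))
    where
    a = ‖ z ‖

    -- The condition of `partialSum-tail` for a tail that starts at index 2.
    2a≤3 : a + a ≤ fromℕ 3
    2a≤3 = begin
      a + a          ≤⟨ +-mono-≤ ‖z‖≤x ‖z‖≤x ⟩
      x + x          ≤⟨ 2x≤1 ⟩
      1#             ≈⟨ +-identityʳ 1# ⟨
      1# + 0#        ≤⟨ +-mono-≤ ≤-refl (fromℕ-nonneg 2) ⟩
      fromℕ 3        ∎

    bound : ∀ n → 2 ℕ.≤ n → ‖ Expᶜ.partialSum z n ℂ-ring.- Expᶜ.partialSum z 2 ‖ ≤ x * x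
    bound n 2≤n = begin
      ‖ Expᶜ.partialSum z n ℂ-ring.- Expᶜ.partialSum z 2 ‖
        ≤⟨ ‖partialSum-diff‖≤ z 2≤n ⟩
      partialSum a n - partialSum a 2
        ≤⟨ +-mono-≤ (partialSum-tail (‖‖-nonneg z) 2a≤3 2≤n) ≤-refl ⟩
      partialSum a 2 + (term a 2 + term a 2) - partialSum a 2
        ≈⟨ solve 3 (λ s k a → s :+ (k :* a :^ 2 :+ k :* a :^ 2) :- s := con (+ 2) :* k :* (a :* a))
             refl (partialSum a 2) (κ 2) a ⟩
      fromℕ 2 * κ 2 * (a * a)
        ≈⟨ *-congʳ (n!κₙ≈1 2) ⟩
      1# * (a * a)
        ≈⟨ *-identityˡ _ ⟩
      a * a
        ≤⟨ *-mono-≤ (‖‖-nonneg z) (≤-trans (‖‖-nonneg z) ‖z‖≤x) ‖z‖≤x ‖z‖≤x ⟩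
      x * x ∎

-- Cosine and sine, their signs, and polar coordinates in a cone.

module Trigonometry {c ℓ₁ ℓ₂} (R : CompleteOrderedField c ℓ₁ ℓ₂) where
  open CompleteOrderedField R renaming (Carrier to ℝ)
  open Analysis R
  open IntegerCoefficients commutativeRing
  open OrderedField R
  open Limits R
  open ComplexExponential R
  open RingProperties ring using (-0#≈0#)
  open RingProperties ℂ-ring.ring using (x[y-z]≈xy-xz)
  open <-Reasoning

  abstract
    -- Opaque, so that the limits behind `exp-exists` never unfold; outside this block its
    -- properties come from `isExp-cis` alone.
    cis : ℝ → ℂ
    cis t = proj₁ (exp-exists (0# +i t))

    isExp-cis : ∀ t → IsExp (0# +i t) (cis t)
    isExp-cis t = proj₂ (exp-exists (0# +i t))

  cos sin : ℝ → ℝ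
  cos t = re (cis t)
  sin t = im (cis t)

  cis-unique : ∀ {t e} → IsExp (0# +i t) e → cis t ≈ᶜ e
  cis-unique {t} = exp-unique (isExp-cis t)

  cis-+ : ∀ s t → cis (s + t) ≈ᶜ cis s *ᶜ cis t
  cis-+ s t = cis-unique (IsExp-cong (+-identityʳ 0# , refl) (exp-+ (isExp-cis s) (isExp-cis t)))

  cis-neg : ∀ t → cis (- t) ≈ᶜ conj (cis t)
  cis-neg t = cis-unique (exp-conj (isExp-cis t))

  cis-cong : ∀ {s t} → s ≈ t → cis s ≈ᶜ cis t
  cis-cong {s} {t} s≈t = cis-unique (IsExp-cong (refl , sym s≈t) (isExp-cis t))

  ‖it‖≤ : ∀ t → ‖ 0# +i t ‖ ≤ ∣ t ∣
  ‖it‖≤ t = ≤-respʳ (+-identityˡ _) (+-mono-≤ (nonneg⇒∣x∣≤x ≤-refl) ≤-refl)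

  cos-0 : cos 0# ≈ 1#
  cos-0 = arbitrarily-close⇒≈ λ ε 0<ε → begin-strict
    ∣ cos 0# - 1# ∣            ≤⟨ ∣∣-cong (+-congˡ (-‿cong (sym (+-identityʳ 1#)))) ⟩
    -- At the argument zero the quadratic error bound itself vanishes.
    ∣ cos 0# - (1# + 0#) ∣     ≤⟨ proj₁ (exp-linear-approximation
                                    (≤-trans (‖it‖≤ 0#) (nonneg⇒∣x∣≤x ≤-refl))
                                    (≤-respˡ (sym (+-identityʳ 0#)) (<⇒≤ 0<1)) (isExp-cis 0#)) ⟩
    0# * 0#                    ≈⟨ zeroˡ 0# ⟩
    0#                         <⟨ 0<ε ⟩
    ε                          ∎

  cos²+sin²≈1 : ∀ t → cos t * cos t + sin t * sin t ≈ 1#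
  cos²+sin²≈1 t = begin-equality
    cos t * cos t + sin t * sin t      ≈⟨ solve 2 (λ a b → a :* a :+ b :* b := a :* a :- b :* :- b) refl (cos t) (sin t) ⟩
    re (cis t *ᶜ conj (cis t))         ≈⟨ proj₁ (ℂ-ring.*-congˡ {cis t} (cis-neg t)) ⟨
    re (cis t *ᶜ cis (- t))            ≈⟨ proj₁ (cis-+ t (- t)) ⟨
    cos (t - t)                        ≈⟨ proj₁ (cis-cong (-‿inverseʳ t)) ⟩
    cos 0#                             ≈⟨ cos-0 ⟩
    1#                                 ∎

  ‖cis-1‖≤ : ∀ {h} → ∣ h ∣ + ∣ h ∣ ≤ 1# → ‖ cis h ℂ-ring.- 1ᶜ ‖ ≤ ∣ h ∣ + ∣ h ∣
  ‖cis-1‖≤ {h} 2∣h∣≤1 = begin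
    ∣ cos h - 1# ∣ + ∣ sin h - 0# ∣
      ≤⟨ +-mono-≤ (∣∣-cong (+-congˡ (-‿cong (sym (+-identityʳ 1#)))))
                  (∣∣-cong (solve 2 (λ s h → s :- con (+ 0) := h :+ (s :- (con (+ 0) :+ h))) refl (sin h) h)) ⟩
    ∣ cos h - (1# + 0#) ∣ + ∣ h + (sin h - (0# + h)) ∣
      ≤⟨ +-mono-≤ ≤-refl (∣x+y∣≤∣x∣+∣y∣ _ _) ⟩
    ∣ cos h - (1# + 0#) ∣ + (∣ h ∣ + ∣ sin h - (0# + h) ∣)
      ≤⟨ +-mono-≤ (proj₁ approx) (+-mono-≤ ≤-refl (proj₂ approx)) ⟩
    ∣ h ∣ * ∣ h ∣ + (∣ h ∣ + ∣ h ∣ * ∣ h ∣)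
      ≈⟨ solve 1 (λ a → a :* a :+ (a :+ a :* a) := a :+ a :* (a :+ a)) refl (∣ h ∣) ⟩
    ∣ h ∣ + ∣ h ∣ * (∣ h ∣ + ∣ h ∣)
      ≤⟨ +-mono-≤ ≤-refl (*-monoˡ-≤ (∣∣-nonneg h) 2∣h∣≤1) ⟩
    ∣ h ∣ + ∣ h ∣ * 1#
      ≈⟨ +-congˡ (*-identityʳ _) ⟩
    ∣ h ∣ + ∣ h ∣ ∎
    where approx = exp-linear-approximation (‖it‖≤ h) 2∣h∣≤1 (isExp-cis h)

  -- With a complex factor `k`, the function `im (k *ᶜ cis t)` ranges over all real combinations of
  -- `cos t` and `sin t`. One continuity proof thus serves both `- sin t` and `x sin t - y cos t`.
  *cis-increment : ∀ k x h → k *ᶜ cis (x + h) ℂ-ring.- k *ᶜ cis x ≈ᶜ k *ᶜ cis x *ᶜ (cis h ℂ-ring.- 1ᶜ)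
  *cis-increment k x h = ℂ-ring.trans
    (ℂ-ring.+-cong (ℂ-ring.trans (ℂ-ring.*-congˡ {k} (cis-+ x h)) (ℂ-ring.sym (ℂ-ring.*-assoc k (cis x) (cis h))))
                   (ℂ-ring.-‿cong (ℂ-ring.sym (ℂ-ring.*-identityʳ (k *ᶜ cis x)))))
    (ℂ-ring.sym (x[y-z]≈xy-xz (k *ᶜ cis x) (cis h) 1ᶜ))

  ∣im-*cis-increment∣≤ : ∀ k x {h} → ∣ h ∣ + ∣ h ∣ ≤ 1# →
    ∣ im (k *ᶜ cis (x + h)) - im (k *ᶜ cis x) ∣ ≤ ‖ k *ᶜ cis x ‖ * (∣ h ∣ + ∣ h ∣)
  ∣im-*cis-increment∣≤ k x {h} 2∣h∣≤1 = begin
    ∣ im (k *ᶜ cis (x + h)) - im (k *ᶜ cis x) ∣    ≤⟨ ∣∣-cong (proj₂ (*cis-increment k x h)) ⟩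
    ∣ im (k *ᶜ cis x *ᶜ (cis h ℂ-ring.- 1ᶜ)) ∣     ≤⟨ ∣im∣≤‖‖ (k *ᶜ cis x *ᶜ (cis h ℂ-ring.- 1ᶜ)) ⟩
    ‖ k *ᶜ cis x *ᶜ (cis h ℂ-ring.- 1ᶜ) ‖          ≤⟨ ‖z*w‖≤ (k *ᶜ cis x) (cis h ℂ-ring.- 1ᶜ) ⟩
    ‖ k *ᶜ cis x ‖ * ‖ cis h ℂ-ring.- 1ᶜ ‖         ≤⟨ *-monoˡ-≤ (‖‖-nonneg (k *ᶜ cis x)) (‖cis-1‖≤ 2∣h∣≤1) ⟩
    ‖ k *ᶜ cis x ‖ * (∣ h ∣ + ∣ h ∣)               ∎

  locally-lipschitz⇒continuous : ∀ {g} → (∀ {x y} → x ≈ y → g x ≈ g y) → (L : ℝ → ℝ) → (∀ x → 0# ≤ L x) →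
    (∀ x {h} → ∣ h ∣ + ∣ h ∣ ≤ 1# → ∣ g (x + h) - g x ∣ ≤ L x * (∣ h ∣ + ∣ h ∣)) → Continuous g
  locally-lipschitz⇒continuous {g} g-cong L 0≤L increment x ε 0<ε =
    let δ₁ , 0<δ₁ , 2δ₁≈1 = halve 0<1
        -- The increment is at most `2 L δ₂`; the extra `1#` keeps the divisor positive when `L x`
        -- is zero and makes the final bound strict.
        δ₂ , 0<δ₂ , [1+2L]δ₂≈ε = divide-pos 0<ε (+-pos-nonneg 0<1 (+-nonneg (0≤L x) (0≤L x)))
        δ , 0<δ , δ≤δ₁ , δ≤δ₂ = common-lower-bound 0<δ₁ 0<δ₂
    in δ , 0<δ , λ y ∣y-x∣<δ →
      let ∣h∣≤δ₁ = ≤-trans (<⇒≤ ∣y-x∣<δ) δ≤δ₁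
          ∣h∣≤δ₂ = ≤-trans (<⇒≤ ∣y-x∣<δ) δ≤δ₂
      in begin-strict
        ∣ g y - g x ∣
          ≤⟨ ∣∣-cong (+-congʳ (g-cong (solve 2 (λ x y → y := x :+ (y :- x)) refl x y))) ⟩
        ∣ g (x + (y - x)) - g x ∣
          ≤⟨ increment x (≤-respʳ 2δ₁≈1 (+-mono-≤ ∣h∣≤δ₁ ∣h∣≤δ₁)) ⟩
        L x * (∣ y - x ∣ + ∣ y - x ∣)
          ≤⟨ *-monoˡ-≤ (0≤L x) (+-mono-≤ ∣h∣≤δ₂ ∣h∣≤δ₂) ⟩
        L x * (δ₂ + δ₂)
          <⟨ <-by 0<δ₂ (trans (sym (*-identityˡ δ₂))
               (solve 3 (λ L d o → o :* d := (o :+ (L :+ L)) :* d :- L :* (d :+ d)) refl (L x) δ₂ 1#)) ⟩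
        (1# + (L x + L x)) * δ₂
          ≈⟨ [1+2L]δ₂≈ε ⟩
        ε ∎

  im-*cis-continuous : ∀ k → Continuous (λ t → im (k *ᶜ cis t))
  im-*cis-continuous k = locally-lipschitz⇒continuous
    (λ s≈t → proj₂ (ℂ-ring.*-congˡ {k} (cis-cong s≈t)))
    (λ x → ‖ k *ᶜ cis x ‖) (λ x → ‖‖-nonneg (k *ᶜ cis x)) (∣im-*cis-increment∣≤ k)

  -- The linear approximation gives `sin h ≥ h - h²`, and `2h ≤ 1` gives `2h² ≤ h`. Hence
  -- `2 sin h ≥ h > 0`.
  sin-positive-near-0 : ∀ {h} → 0# < h → h + h ≤ 1# → 0# < sin h
  sin-positive-near-0 {h} 0<h 2h≤1 = *-cancelˡ-pos {1# + 1#} (+-pos 0<1 0<1)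
    (<-by (<-≤-trans 0<h (≤-by (+-nonneg (+-nonneg 0≤d 0≤d) (*-nonneg (<⇒≤ 0<h) (x≤y⇒0≤y-x 2h≤1))) (begin-equality
      d + d + h * (1# - (h + h))
        ≈⟨ solve 3 (λ s h o → s :+ h :* h :- (con (+ 0) :+ h) :+ (s :+ h :* h :- (con (+ 0) :+ h))
                                :+ h :* (o :- (h :+ h)) := s :+ s :- h :+ (h :* o :- h)) refl (sin h) h 1# ⟩
      sin h + sin h - h + (h * 1# - h)
        ≈⟨ +-congˡ (trans (+-congʳ (*-identityʳ h)) (-‿inverseʳ h)) ⟩
      sin h + sin h - h + 0#
        ≈⟨ +-identityʳ _ ⟩
      sin h + sin h - h ∎)))
      (trans (+-cong (sym (*-identityˡ _)) (sym (*-identityˡ _)))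
        (solve 2 (λ s o → o :* s :+ o :* s := (o :+ o) :* s :- con (+ 0)) refl (sin h) 1#)))
    where
    d = sin h + h * h - (0# + h)
    0≤d : 0# ≤ d
    0≤d = x≤y⇒0≤y-x (∣x-y∣≤b⇒y≤x+b (proj₂ (exp-linear-approximation
      (≤-trans (‖it‖≤ h) (nonneg⇒∣x∣≤x (<⇒≤ 0<h))) 2h≤1 (isExp-cis h))))

  sin-positive-below : ∀ {x} → 0# < x → ∃[ h ] 0# < h × h < x × 0# < sin h
  sin-positive-below {x} 0<x =
    let δ₁ , 0<δ₁ , 2δ₁≈1 = halve 0<1
        δ₂ , 0<δ₂ , 2δ₂≈x = halve 0<x
        h , 0<h , h≤δ₁ , h≤δ₂ = common-lower-bound 0<δ₁ 0<δ₂
    in h , 0<h ,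
       ≤-<-trans h≤δ₂ (<-by 0<δ₂ (trans (solve 1 (λ d → d := d :+ d :- d) refl δ₂) (+-congʳ 2δ₂≈x))) ,
       sin-positive-near-0 0<h (≤-respʳ 2δ₁≈1 (+-mono-≤ h≤δ₁ h≤δ₁))

  sin-zero-between : ∀ {α β} → α < β → 0# < sin α → sin β < 0# → ∃[ t ] α < t × t < β × sin t ≈ 0#
  sin-zero-between {α} {β} α<β 0<sinα sinβ<0 =
    -- `intermediate-value` expects an upward crossing, so it is applied to `- sin`.
    let t , α<t , t<β , im≈0 = intermediate-value (im-*cis-continuous -1ᶜ) α<β
          (<-by 0<sinα (trans (solve 1 (λ s → s := con (+ 0) :- :- s) refl (sin α)) (+-congˡ (-‿cong (sym (im-neg α))))))
          (<-respʳ-≈ (sym (im-neg β)) (neg-pos sinβ<0))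
    in t , α<t , t<β ,
       trans (solve 1 (λ s → s := :- :- s) refl (sin t)) (trans (-‿cong (trans (sym (im-neg t)) im≈0)) -0#≈0#)
    where
    -1ᶜ : ℂ
    -- `fromℕ 1` instead of `1#`, to agree with the solver's `con (+ 1)`.
    -1ᶜ = - fromℕ 1 +i 0#
    im-neg : ∀ t → im (-1ᶜ *ᶜ cis t) ≈ - sin t
    im-neg t = solve 2 (λ a b → :- con (+ 1) :* b :+ con (+ 0) :* a := :- b) refl (cos t) (sin t)

  sin≈0⇒IsSin : ∀ {t} → sin t ≈ 0# → IsSin t 0#
  sin≈0⇒IsSin {t} sin≈0 = cos t , ⟶ᶜ-cong (λ _ → ℂ-ring.refl) (refl , sin≈0) (isExp-cis t)

  sin-pos : ∀ {π} → IsPi π → ∀ {x} → 0# < x → x < π → 0# < sin x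
  sin-pos {π} (_ , _ , π-least) {x} 0<x x<π with compare (sin x) 0#
  ... | tri> _ _ 0<sin = 0<sin
  ... | tri≈ _ sin≈0 _ = ⊥-elim (π-least x 0<x x<π (sin≈0⇒IsSin sin≈0))
  ... | tri< sin<0 _ _ =
    let h , 0<h , h<x , 0<sinh = sin-positive-below 0<x
        t , h<t , t<x , sin≈0 = sin-zero-between h<x 0<sinh sin<0
    in ⊥-elim (π-least t (<-trans 0<h h<t) (<-trans t<x x<π) (sin≈0⇒IsSin sin≈0))

  cos-pos : ∀ {π} → IsPi π → ∀ {θ} → 0# < θ → θ + θ < π → 0# < cos θ
  cos-pos isPi {θ} 0<θ 2θ<π = *-cancelˡ-pos {sin θ + sin θ} (+-pos 0<sin 0<sin) (begin-strict
    0#                             <⟨ sin-pos isPi (+-pos 0<θ 0<θ) 2θ<π ⟩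
    sin (θ + θ)                    ≈⟨ proj₂ (cis-+ θ θ) ⟩
    cos θ * sin θ + sin θ * cos θ  ≈⟨ solve 2 (λ a s → a :* s :+ s :* a := (s :+ s) :* a) refl (cos θ) (sin θ) ⟩
    (sin θ + sin θ) * cos θ        ∎)
    where
    0<sin : 0# < sin θ
    0<sin = sin-pos isPi 0<θ (<-trans (<-by 0<θ (solve 1 (λ t → t := t :+ t :- t) refl θ)) 2θ<π)

  -- The second hypothesis says that `(x, y)` is parallel to the unit vector `(p, q)`. Its
  -- orthogonal projection onto that vector, with coefficient `x p + y q`, is therefore `(x, y)`
  -- itself.
  projection-of-parallel : ∀ {p q x y} → p * p + q * q ≈ 1# → x * q + - y * p ≈ 0# →
    (x * p + y * q) * p ≈ x × (x * p + y * q) * q ≈ y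
  projection-of-parallel {p} {q} {x} {y} unit parallel =
    (begin-equality
      (x * p + y * q) * p
        ≈⟨ solve 4 (λ x y p q → (x :* p :+ y :* q) :* p :=
             x :* (p :* p :+ q :* q) :- q :* (x :* q :+ :- y :* p)) refl x y p q ⟩
      x * (p * p + q * q) - q * (x * q + - y * p)
        ≈⟨ +-cong (*-congˡ unit) (-‿cong (*-congˡ parallel)) ⟩
      x * 1# - q * 0#
        ≈⟨ +-cong (*-identityʳ x) (trans (-‿cong (zeroʳ q)) -0#≈0#) ⟩
      x + 0#
        ≈⟨ +-identityʳ x ⟩
      x ∎) ,
    (begin-equality
      (x * p + y * q) * q
        ≈⟨ solve 4 (λ x y p q → (x :* p :+ y :* q) :* q :=
             y :* (p :* p :+ q :* q) :+ p :* (x :* q :+ :- y :* p)) refl x y p q ⟩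
      y * (p * p + q * q) + p * (x * q + - y * p)
        ≈⟨ +-cong (*-congˡ unit) (*-congˡ parallel) ⟩
      y * 1# + p * 0#
        ≈⟨ +-cong (*-identityʳ y) (zeroʳ p) ⟩
      y + 0#
        ≈⟨ +-identityʳ y ⟩
      y ∎)

  sin-- : ∀ s t → sin (s - t) ≈ cos s * - sin t + sin s * cos t
  sin-- s t = trans (proj₂ (cis-+ s (- t))) (proj₂ (ℂ-ring.*-congˡ {cis s} (cis-neg t)))

  -- The zero φ of t ↦ x sin t - y cos t makes (x, y) a multiple ρ of
  -- (cos φ, sin φ), and ρ sin (θ - φ) = x sin θ - y cos θ shows ρ > 0.
  polar-coordinates : ∀ {π} → IsPi π → ∀ {θ} → 0# < θ → θ + θ < π →
    ∀ {x y} → ∣ y ∣ * cos θ < x * sin θ →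
    ∃[ ρ ] ∃[ φ ] 0# < ρ × ∣ φ ∣ < θ × ρ * cos φ ≈ x × ρ * sin φ ≈ y
  polar-coordinates {π} isPi {θ} 0<θ 2θ<π {x} {y} in-cone =
    let φ , -θ<φ , φ<θ , g≈0 = intermediate-value (im-*cis-continuous k) -θ<θ g[-θ]<0 0<g[θ]
        ρcos≈x , ρsin≈y = projection-of-parallel (cos²+sin²≈1 φ) g≈0
    in x * cos φ + y * sin φ , φ , ρ-pos φ -θ<φ φ<θ ρcos≈x ρsin≈y ,
       ∣∣-lub-< φ<θ (<-by (x<y⇒0<y-x -θ<φ) (solve 2 (λ t p → p :- :- t := t :- :- p) refl θ φ)) ,
       ρcos≈x , ρsin≈y
    where
    k : ℂ
    k = x +i (- y)

    -θ<θ : - θ < θ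
    -θ<θ = <-by (+-pos 0<θ 0<θ) (solve 1 (λ t → t :+ t := t :- :- t) refl θ)

    -- Used with `t = - y` at the end point `- θ` and with `t = y` at `θ`: the absolute value in the
    -- hypothesis supplies both signs.
    cone : ∀ t → t ≤ ∣ y ∣ → 0# < x * sin θ - t * cos θ
    cone t t≤∣y∣ = x<y⇒0<y-x (≤-<-trans (≤-respˡ (*-comm _ _) (≤-respʳ (*-comm _ _)
      (*-monoˡ-≤ (<⇒≤ (cos-pos isPi 0<θ 2θ<π)) t≤∣y∣))) in-cone)

    g[-θ]<0 : im (k *ᶜ cis (- θ)) < 0#
    g[-θ]<0 = <-by (cone (- y) (-x≤∣x∣ y)) (trans
      (solve 4 (λ x y a s → x :* s :- :- y :* a := con (+ 0) :- (x :* :- s :+ :- y :* a)) refl x y (cos θ) (sin θ))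
      (+-congˡ (-‿cong (sym (proj₂ (ℂ-ring.*-congˡ {k} (cis-neg θ)))))))

    0<g[θ] : 0# < im (k *ᶜ cis θ)
    0<g[θ] = <-respʳ-≈
      (solve 4 (λ x y a s → x :* s :- y :* a := x :* s :+ :- y :* a) refl x y (cos θ) (sin θ))
      (cone y (x≤∣x∣ y))

    ρ-pos : ∀ φ {ρ} → - θ < φ → φ < θ → ρ * cos φ ≈ x → ρ * sin φ ≈ y → 0# < ρ
    ρ-pos φ {ρ} -θ<φ φ<θ ρcos≈x ρsin≈y = *-cancelˡ-pos 0<sin[θ-φ] (begin-strict
      0#                                                 <⟨ cone y (x≤∣x∣ y) ⟩
      x * sin θ - y * cos θ                              ≈⟨ +-cong (*-congʳ ρcos≈x) (-‿cong (*-congʳ ρsin≈y)) ⟨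
      ρ * cos φ * sin θ - ρ * sin φ * cos θ              ≈⟨ solve 5 (λ r p q a s →
                                                              r :* p :* s :- r :* q :* a := (a :* :- q :+ s :* p) :* r)
                                                              refl ρ (cos φ) (sin φ) (cos θ) (sin θ) ⟩
      (cos θ * - sin φ + sin θ * cos φ) * ρ              ≈⟨ *-congʳ (sin-- θ φ) ⟨
      sin (θ - φ) * ρ                                    ∎)
      where
      0<sin[θ-φ] : 0# < sin (θ - φ)
      0<sin[θ-φ] = sin-pos isPi (x<y⇒0<y-x φ<θ) (<-trans
        (<-by (x<y⇒0<y-x -θ<φ) (solve 2 (λ t p → p :- :- t := t :+ t :- (t :- p)) refl θ φ)) 2θ<π)

-- Inversion carries the lens into the sector.

module SectorAndLens {c ℓ₁ ℓ₂} (R : CompleteOrderedField c ℓ₁ ℓ₂) where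
  open CompleteOrderedField R renaming (Carrier to ℝ)
  open Analysis R
  open IntegerCoefficients commutativeRing
  open OrderedField R
  open ComplexExponential R
  open Trigonometry R
  open Exp commutativeSemiring using (_^_; ^-congˡ)
  open RingProperties ring using (-‿distribˡ-*)
  open <-Reasoning

  ∣x∣²≈x² : ∀ x → ∣ x ∣ * ∣ x ∣ ≈ x * x
  ∣x∣²≈x² x with ∣x∣-cases x
  ... | inj₁ (_ , eq) rewrite eq = refl
  ... | inj₂ (_ , eq) rewrite eq = solve 1 (λ x → :- x :* :- x := x :* x) refl x

  -- With a² + s² = 1 the bound on |y| squares to v (x² + y²) + |y| a / s < x.
  lens-inequality : ∀ {v a s q x y} → 0# < v → 0# < a → 0# < s → a * a + s * s ≈ 1# →
    IsSqrt (1# / (fromℕ 4 * v ^ 2 * s ^ 2) - (x - 1# / (fromℕ 2 * v)) ^ 2) q →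
    ∣ y ∣ < (- 1#) / (fromℕ 2 * v * (s / a)) + q →
    ∣ y ∣ * a < s * (x - v * (x * x + y * y))
  lens-inequality {v} {a} {s} {q} {x} {y} 0<v 0<a 0<s a²+s²≈1 (0≤q , q²≈) ∣y∣<q-w =
    <-by (*-cancelˡ-pos (*-pos (fromℕ-pos 4) (*-pos 0<v 0<s)) scaled) refl
    where
    Y = ∣ y ∣
    -- `P` is the squared radius, and `t` and `w` locate the centres `t ± i w` of the two discs.
    -- Then `0# < D - m * m` places the point in both of them.
    P = (fromℕ 4 * v ^ 2 * s ^ 2) ⁻¹
    t = (fromℕ 2 * v) ⁻¹
    w = (fromℕ 2 * v * (s / a)) ⁻¹
    m = Y + w
    D = 1# * P - (x - 1# * t) ^ 2

    0<2v : 0# < fromℕ 2 * v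
    0<2v = *-pos (fromℕ-pos 2) 0<v

    0<2vs/a : 0# < fromℕ 2 * v * (s / a)
    0<2vs/a = *-pos 0<2v (*-pos 0<s (⁻¹-pos 0<a))

    0<4v²s² : 0# < fromℕ 4 * v ^ 2 * s ^ 2
    0<4v²s² = <-respʳ-≈ (solve 2 (λ v s → con (+ 2) :* v :* s :* (con (+ 2) :* v :* s)
                                       := con (+ 4) :* v :^ 2 :* s :^ 2) refl v s)
                (*-pos (*-pos 0<2v 0<s) (*-pos 0<2v 0<s))

    2vsw≈a : fromℕ 2 * v * s * w ≈ a
    2vsw≈a = begin-equality
      fromℕ 2 * v * s * w                      ≈⟨ *-identityʳ _ ⟨
      fromℕ 2 * v * s * w * 1#                 ≈⟨ *-congˡ (pos⇒x*x⁻¹≈1 0<a) ⟨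
      fromℕ 2 * v * s * w * (a * a ⁻¹)         ≈⟨ solve 5 (λ v s w a a⁻ → con (+ 2) :* v :* s :* w :* (a :* a⁻)
                                                    := con (+ 2) :* v :* (s :* a⁻) :* w :* a) refl v s w a (a ⁻¹) ⟩
      fromℕ 2 * v * (s / a) * w * a            ≈⟨ *-congʳ (pos⇒x*x⁻¹≈1 0<2vs/a) ⟩
      1# * a                                   ≈⟨ *-identityˡ a ⟩
      a                                        ∎

    m<q : m < q
    m<q = <-by (x<y⇒0<y-x ∣y∣<q-w) (trans
      (+-congʳ (+-congʳ (trans (sym (-‿distribˡ-* 1# w)) (-‿cong (*-identityˡ w)))))
      (solve 3 (λ Y w q → :- w :+ q :- Y := q :- (Y :+ w)) refl Y w q))

    -- Squaring preserves the order since `0# ≤ m < q`; the difference of squares is factored as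
    -- `(q - m)(q + m)`.
    0<D-m² : 0# < D - m * m
    0<D-m² = <-respʳ-≈
      (trans (solve 2 (λ q m → (q :- m) :* (q :+ m) := q :* q :- m :* m) refl q m) (+-congʳ q²≈))
      (*-pos (x<y⇒0<y-x m<q)
             (+-pos-nonneg (≤-<-trans (+-nonneg (∣∣-nonneg y) (<⇒≤ (⁻¹-pos 0<2vs/a))) m<q)
                           (+-nonneg (∣∣-nonneg y) (<⇒≤ (⁻¹-pos 0<2vs/a)))))

    scaled : 0# < fromℕ 4 * (v * s) * (s * (x - v * (x * x + y * y)) - Y * a)
    scaled = begin-strict
      0#
        <⟨ *-pos 0<4v²s² 0<D-m² ⟩
      fromℕ 4 * v ^ 2 * s ^ 2 * (D - m * m)
        ≈⟨ *-congˡ (+-congʳ (+-cong (*-identityˡ P) (-‿cong (^-congˡ 2 (+-congˡ (-‿cong (*-identityˡ t))))))) ⟩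
      fromℕ 4 * v ^ 2 * s ^ 2 * (P - (x - t) ^ 2 - m * m)
        -- The solver knows nothing of inverses. The identity only regroups the factors so that `P`,
        -- `t` and `w` appear inside `4 v² s² P`, `2 v t` and `2 v s w`, which the next step
        -- replaces by `a² + s²`, `1` and `a`.
        ≈⟨ solve 7 (λ v s P x t Y w →
             con (+ 4) :* v :^ 2 :* s :^ 2 :* (P :- (x :- t) :^ 2 :- (Y :+ w) :* (Y :+ w)) :=
             con (+ 4) :* v :^ 2 :* s :^ 2 :* P
             :- con (+ 4) :* (v :* s) :* (v :* s) :* (x :* x :+ Y :* Y)
             :+ con (+ 2) :* v :* t :* (con (+ 4) :* (v :* s) :* s :* x)
             :- con (+ 2) :* v :* t :* (con (+ 2) :* v :* t) :* (s :* s)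
             :- con (+ 4) :* (v :* s) :* Y :* (con (+ 2) :* v :* s :* w)
             :- con (+ 2) :* v :* s :* w :* (con (+ 2) :* v :* s :* w)) refl v s P x t Y w ⟩
      fromℕ 4 * v ^ 2 * s ^ 2 * P
        - fromℕ 4 * (v * s) * (v * s) * (x * x + Y * Y)
        + fromℕ 2 * v * t * (fromℕ 4 * (v * s) * s * x)
        - fromℕ 2 * v * t * (fromℕ 2 * v * t) * (s * s)
        - fromℕ 4 * (v * s) * Y * (fromℕ 2 * v * s * w)
        - fromℕ 2 * v * s * w * (fromℕ 2 * v * s * w)
        ≈⟨ +-cong (+-cong (+-cong (+-cong
             (+-cong (trans (pos⇒x*x⁻¹≈1 0<4v²s²) (sym a²+s²≈1))
                     (-‿cong (*-congˡ (+-congˡ (∣x∣²≈x² y)))))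
             (trans (*-congʳ 2vt≈1) (*-identityˡ _)))
             (-‿cong (trans (*-congʳ (trans (*-cong 2vt≈1 2vt≈1) (*-identityˡ 1#))) (*-identityˡ _))))
             (-‿cong (*-congˡ 2vsw≈a)))
             (-‿cong (*-cong 2vsw≈a 2vsw≈a)) ⟩
      a * a + s * s
        - fromℕ 4 * (v * s) * (v * s) * (x * x + y * y)
        + fromℕ 4 * (v * s) * s * x
        - s * s
        - fromℕ 4 * (v * s) * Y * a
        - a * a
        -- Since `1` was written as `a² + s²`, the squares left by `t` and `w` cancel, and
        -- everything that remains is divisible by `4 v s`.
        ≈⟨ solve 6 (λ v a s x y Y →
             a :* a :+ s :* s :- con (+ 4) :* (v :* s) :* (v :* s) :* (x :* x :+ y :* y)
             :+ con (+ 4) :* (v :* s) :* s :* x :- s :* s :- con (+ 4) :* (v :* s) :* Y :* a :- a :* a :=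
             con (+ 4) :* (v :* s) :* (s :* (x :- v :* (x :* x :+ y :* y)) :- Y :* a)) refl v a s x y Y ⟩
      fromℕ 4 * (v * s) * (s * (x - v * (x * x + y * y)) - Y * a) ∎
      where
      2vt≈1 : fromℕ 2 * v * t ≈ 1#
      2vt≈1 = pos⇒x*x⁻¹≈1 0<2v

  inverse∈Sector : ∀ {π} → IsPi π → ∀ {θ} → 0# < θ → θ + θ < π → ∀ {v} → 0# < v →
    ∀ {z} → z ∈ Lens v θ → ∃[ w ] w *ᶜ z ≈ᶜ 1ᶜ × w ∈ Sector v θ
  inverse∈Sector isPi {θ} 0<θ 2θ<π {v} 0<v {x +i y}
    (a , s , q , (b , exp₁) , (a′ , exp₂) , isSqrt , 0<x , _ , ∣y∣<) =
    let ρ , φ , 0<ρ , ∣φ∣<θ , ρcos≈X , ρsin≈Y = polar-coordinates isPi 0<θ 2θ<π {x = X} {y = - (y * i)} in-cone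
    -- The inverse of `z` is its conjugate divided by `x² + y²`.
    in (x * i +i (- (y * i))) ,
       ( trans (solve 3 (λ x y i → x :* i :* x :- :- (y :* i) :* y := (x :* x :+ y :* y) :* i) refl x y i) ri≈1
       , solve 3 (λ x y i → x :* i :* y :+ :- (y :* i) :* x := con (+ 0)) refl x y i ) ,
       ρ , φ , cis φ , 0<ρ , ∣φ∣<θ , isExp-cis φ ,
       ( (begin-equality
           x * i                                  ≈⟨ solve 2 (λ v u → u := v :+ (u :- v)) refl v (x * i) ⟩
           v + X                                  ≈⟨ +-congˡ ρcos≈X ⟨
           v + ρ * cos φ                          ≈⟨ solve 4 (λ v r c s → v :+ r :* c := v :+ (r :* c :- con (+ 0) :* s))
                                                       refl v ρ (cos φ) (sin φ) ⟩
           v + (ρ * cos φ - 0# * sin φ)           ∎)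
       , (begin-equality
           - (y * i)                              ≈⟨ ρsin≈Y ⟨
           ρ * sin φ                              ≈⟨ solve 3 (λ r c s → r :* s := con (+ 0) :+ (r :* s :+ con (+ 0) :* c))
                                                       refl ρ (cos φ) (sin φ) ⟩
           0# + (ρ * sin φ + 0# * cos φ)          ∎) )
    where
    r = x * x + y * y
    i = r ⁻¹
    X = x * i - v

    0<r : 0# < r
    0<r = +-pos-nonneg (*-pos 0<x 0<x) (square-nonneg y)

    ri≈1 : r * i ≈ 1#
    ri≈1 = pos⇒x*x⁻¹≈1 0<r

    -- `IsCos` and `IsSin` each bring an exponential of their own; uniqueness of limits identifies
    -- both with `cis θ`, so that `a² + s² ≈ 1` becomes available.
    a≈cos : a ≈ cos θ
    a≈cos = sym (proj₁ (cis-unique exp₁))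

    s≈sin : s ≈ sin θ
    s≈sin = sym (proj₂ (cis-unique exp₂))

    0<cos : 0# < cos θ
    0<cos = cos-pos isPi 0<θ 2θ<π

    0<sin : 0# < sin θ
    0<sin = sin-pos isPi 0<θ (<-trans (<-by 0<θ (solve 1 (λ t → t := t :+ t :- t) refl θ)) 2θ<π)

    lens : ∣ y ∣ * a < s * (x - v * r)
    lens = lens-inequality 0<v (<-respʳ-≈ (sym a≈cos) 0<cos) (<-respʳ-≈ (sym s≈sin) 0<sin)
      (trans (+-cong (*-cong a≈cos a≈cos) (*-cong s≈sin s≈sin)) (cos²+sin²≈1 θ)) isSqrt ∣y∣<

    in-cone : ∣ - (y * i) ∣ * cos θ < X * sin θ
    in-cone = begin-strict
      ∣ - (y * i) ∣ * cos θ
        ≈⟨ *-comm _ _ ⟩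
      cos θ * ∣ - (y * i) ∣
        ≤⟨ *-monoˡ-≤ (<⇒≤ 0<cos) (≤-trans (∣-x∣≤∣x∣ (y * i)) (≤-trans (∣x*y∣≤∣x∣*∣y∣ y i)
             (*-monoˡ-≤ (∣∣-nonneg y) (nonneg⇒∣x∣≤x (<⇒≤ (⁻¹-pos 0<r)))))) ⟩
      cos θ * (∣ y ∣ * i)
        ≈⟨ *-congʳ a≈cos ⟨
      a * (∣ y ∣ * i)
        -- The lens inequality multiplied by `i`, that is, divided by `x² + y²`.
        <⟨ <-by (*-pos (⁻¹-pos 0<r) (x<y⇒0<y-x lens))
             (solve 7 (λ a s x v r i Y → i :* (s :* (x :- v :* r) :- Y :* a) :=
                s :* (x :* i) :- s :* v :* (r :* i) :- a :* (Y :* i)) refl a s x v r i (∣ y ∣)) ⟩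
      s * (x * i) - s * v * (r * i)
        ≈⟨ +-congˡ (-‿cong (trans (*-congˡ ri≈1) (*-identityʳ _))) ⟩
      s * (x * i) - s * v
        ≈⟨ solve 3 (λ s u v → s :* u :- s :* v := (u :- v) :* s) refl s (x * i) v ⟩
      X * s
        ≈⟨ *-congˡ s≈sin ⟩
      X * sin θ ∎

  -- For `n = m + 3` and `θ = π / n` one has `π - 2θ = (n - 2) θ = (m + 1) θ`, a positive multiple
  -- of `θ`.
  π/n-bounds : ∀ {π} → 0# < π → ∀ {n} → 3 ℕ.≤ n → 0# < π / fromℕ n × π / fromℕ n + π / fromℕ n < π
  π/n-bounds {π} 0<π {suc (suc (suc m))} (ℕ.s≤s (ℕ.s≤s (ℕ.s≤s _))) =
    0<θ , <-by (*-pos (fromℕ-pos (suc m)) 0<θ) (begin-equality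
      fromℕ (suc m) * θ
        ≈⟨ solve 2 (λ N t → N :* t := (con (+ 2) :+ N) :* t :- (t :+ t)) refl (fromℕ (suc m)) θ ⟩
      (fromℕ 2 + fromℕ (suc m)) * θ - (θ + θ)
        ≈⟨ +-congʳ (*-congʳ (solve 2 (λ o N → o :+ (o :+ con (+ 0)) :+ N := o :+ (o :+ N)) refl 1# (fromℕ (suc m)))) ⟩
      fromℕ n * (π * fromℕ n ⁻¹) - (θ + θ)
        ≈⟨ +-congʳ (solve 3 (λ N p k → N :* (p :* k) := p :* (N :* k)) refl (fromℕ n) π (fromℕ n ⁻¹)) ⟩
      π * (fromℕ n * fromℕ n ⁻¹) - (θ + θ)
        ≈⟨ +-congʳ (trans (*-congˡ (pos⇒x*x⁻¹≈1 (fromℕ-pos n))) (*-identityʳ π)) ⟩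
      π - (θ + θ) ∎)
    where
    n = suc (suc (suc m))
    θ = π / fromℕ n
    0<θ : 0# < θ
    0<θ = *-pos 0<π (⁻¹-pos (fromℕ-pos n))

  reciprocal-root : ∀ {n} (f : Polynomial n) {w z} → w *ᶜ z ≈ᶜ 1ᶜ → IsRoot f z → IsRoot (reciprocal f) w
  reciprocal-root f wz≈1 fz≈0 =
    ℂ-ring.trans (eval-reciprocal f wz≈1) (ℂ-ring.trans (ℂ-ring.*-congˡ fz≈0) (ℂ-ring.zeroʳ _))

lemma2p14 : ∀ {c ℓ₁ ℓ₂} (R : CompleteOrderedField c ℓ₁ ℓ₂) →
  let open CompleteOrderedField R renaming (Carrier to ℝ)
      open Analysis R
  in
  ∀ (π : ℝ) → IsPi π →
  ∀ (n : ℕ) → 3 ℕ.≤ n →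
  ∀ (f : Polynomial n) → ¬ (last f ≈ 0#) → ¬ (IsRoot f 0ᶜ) →
  ∀ (ṽ : ℝ) → 0# < ṽ →
  (∀ z → z ∈ Sector ṽ (π / fromℕ n) → ¬ (IsRoot (reciprocal f) z)) →
  ∀ z → z ∈ Lens ṽ (π / fromℕ n) → ¬ (IsRoot f z)
lemma2p14 R π isPi n 3≤n f _ _ ṽ 0<ṽ no-root z z∈Lens fz≈0 =
  let open SectorAndLens R
      0<θ , 2θ<π = π/n-bounds (proj₁ isPi) 3≤n
      w , wz≈1 , w∈Sector = inverse∈Sector isPi 0<θ 2θ<π 0<ṽ z∈Lens
  in no-root w w∈Sector (reciprocal-root f wz≈1 fz≈0)
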